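{- There is an absolute constant $C>0$ such that the following holds. Let $\gamma>0$, let $G$ be a $\gamma$-expanding projection game, and suppose $\lambda_+(G)>1-\varepsilon$. Then $\|G\|>1-C\varepsilon/\gamma$.
   Context: Projection games. A projection game $G$ is given by finite vertex sets $U,V$, a finite alphabet $\Sigma$, and a finite nonnegatively weighted bipartite multigraph between $U$ and $V$ whose edges carry constraints $\pi\subseteq\Sigma\times\Sigma$ such that for every $\beta\in\Sigma$ there is at most one $\alpha\in\Sigma$ with $(\alpha,\beta)\in\pi$. Choosing an edge with probability proportional to its weight gives a distribution on triples $(u,v,\pi)$, whose marginals are the probability measures on $U$ and $V$ (every vertex is assumed to have positive measure); $(v,\pi)|u$ denotes the distribution conditioned on $u$. Collision value. $G$ is identified with the operator $Gf(u,\alpha)=\mathbb{E}_{(v,\pi)|u}\sum_{\beta:(\alpha,\beta)\in\pi}f(v,\beta)$ from functions on $V\times\Sigma$ to functions on $U\times\Sigma$, where $\|g\|^2=\mathbb{E}_u\sum_\alpha g(u,\alpha)^2$. An assignment is a nonnegative $f:V\times\Sigma\to\mathbb{R}$ with $\sum_\beta f(v,\beta)=1$ for all $v$; the collision value is $\|G\|=\max_f\|Gf\|$ over assignments $f$. The parameter $\lambda_+$. $\lambda_+(G)=\max_{h}\|Gh\|/\|Th\|$ over nonnegative $h:V\times\Sigma\to\mathbb{R}$ with nonzero denominator, where $\|Th\|^2=\mathbb{E}_v\big(\sum_\beta h(v,\beta)\big)^2$, with $v$ distributed according to the measure on $V$. Expansion. Draw $u$ from the measure on $U$, then $(v,\pi)|u$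 and $(v',\pi')|u$ independently; this gives a symmetric distribution on pairs $(v,v')\in V\times V$. Let $A_{v_1,v_2}$ be the conditional probability that $v'=v_2$ given $v=v_1$. $A$ is a stochastic matrix, self-adjoint with respect to the measure on $V$, with real eigenvalues $1=\lambda_1\ge\lambda_2\ge\dots\ge\lambda_n$. $G$ is $\gamma$-expanding if $1-\max(|\lambda_2|,|\lambda_n|)\ge\gamma$. -}

module Defs where

open import Algebra.Bundles using (CommutativeRing)
open import Algebra.Structures using (IsCommutativeRing)
import Algebra.Construct.NaturalChoice.Max as NaturalMax
import Algebra.Properties.Monoid.Sum as MonoidSum
import Algebra.Properties.Ring as RingProperties
open import Data.Bool.Base using (Bool; true; if_then_else_)
open import Data.Fin.Base as Fin using (Fin; zero; suc; fromℕ)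
open import Data.Fin.Properties using (_≟_)
open import Data.Nat.Base using (ℕ; zero; suc)
open import Data.Product.Base using (∃; ∃-syntax; Σ-syntax; _×_; _,_; proj₁)
open import Data.Sum.Base using (inj₁; inj₂)
open import Level using (Level) renaming (suc to lsuc)
open import Relation.Binary.Bundles using (TotalOrder)
open import Relation.Binary.Core using (Rel)
import Relation.Binary.Construct.NonStrictToStrict as ToStrict
open import Relation.Binary.PropositionalEquality.Core using (_≡_)
open import Relation.Binary.Structures using (IsDecTotalOrder)
open import Relation.Nullary using (¬_; yes; no; does)
open import Relation.Unary using (Pred)

-- The real numbers are axiomatised as a Dedekind-complete (decidably) ordered
-- field; classically there is exactly one up to isomorphism.

record CompleteOrderedField (ℓ : Level) : Set (lsuc ℓ) where
  infix  4 _≈_ _≤_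
  infixl 6 _+_
  infixl 7 _*_
  infix  8 -_
  field
    Carrier           : Set ℓ
    _≈_ _≤_           : Rel Carrier ℓ
    _+_ _*_           : Carrier → Carrier → Carrier
    -_                : Carrier → Carrier
    0# 1#             : Carrier
    isCommutativeRing : IsCommutativeRing _≈_ _+_ _*_ -_ 0# 1#
    isDecTotalOrder   : IsDecTotalOrder _≈_ _≤_
    0≉1               : ¬ (0# ≈ 1#)
    inverse           : ∀ x → ¬ (x ≈ 0#) → ∃[ y ] x * y ≈ 1#
    +-monoˡ-≤         : ∀ z {x y} → x ≤ y → x + z ≤ y + z
    *-nonneg          : ∀ {x y} → 0# ≤ x → 0# ≤ y → 0# ≤ x * y

  IsUpperBound : Pred Carrier ℓ → Carrier → Set ℓ
  IsUpperBound P b = ∀ x → P x → x ≤ b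

  IsSupremum : Pred Carrier ℓ → Carrier → Set ℓ
  IsSupremum P s = IsUpperBound P s × (∀ b → IsUpperBound P b → s ≤ b)

  IsMaximum : Pred Carrier ℓ → Carrier → Set ℓ
  IsMaximum P m = P m × IsUpperBound P m

  field
    complete : ∀ (P : Pred Carrier ℓ) → ∃ P → ∃ (IsUpperBound P) → ∃ (IsSupremum P)

  commutativeRing : CommutativeRing ℓ ℓ
  commutativeRing = record { isCommutativeRing = isCommutativeRing }

  module ring  = CommutativeRing commutativeRing
  module order = IsDecTotalOrder isDecTotalOrder

  totalOrder : TotalOrder ℓ ℓ ℓ
  totalOrder = record { isTotalOrder = order.isTotalOrder }

  open ToStrict _≈_ _≤_ public using (_<_)
  open NaturalMax totalOrder public using (_⊔_)
  open MonoidSum ring.+-monoid public using (sum)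

  infixl 6 _-_
  _-_ : Carrier → Carrier → Carrier
  x - y = x + - y

  ∣_∣ : Carrier → Carrier
  ∣ x ∣ = x ⊔ - x

  -- Totalised by x / 0 = 0.
  infixl 7 _/_
  _/_ : Carrier → Carrier → Carrier
  x / y with y order.≟ 0#
  ... | yes _   = 0#
  ... | no  y≉0 = x * proj₁ (inverse y y≉0)

  -- The set defining the square root is bounded.
  private
    open NaturalMax totalOrder using (x≤x⊔y; x≤y⊔x)
    module ringP = RingProperties ring.ring

    x≤y⇒0≤y-x : ∀ {x y} → x ≤ y → 0# ≤ y - x
    x≤y⇒0≤y-x {x} x≤y = order.≤-respˡ-≈ (ring.-‿inverseʳ x) (+-monoˡ-≤ (- x) x≤y)

    0≤y-x⇒x≤y : ∀ {x y} → 0# ≤ y - x → x ≤ y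
    0≤y-x⇒x≤y {x} {y} 0≤y-x =
      order.≤-respˡ-≈ (ring.+-identityˡ x)
        (order.≤-respʳ-≈
          (ring.trans (ring.+-assoc y (- x) x)
            (ring.trans (ring.+-congˡ (ring.-‿inverseˡ x)) (ring.+-identityʳ y)))
          (+-monoˡ-≤ x 0≤y-x))

    0≤1 : 0# ≤ 1#
    0≤1 with order.total 0# 1#
    ... | inj₁ p = p
    ... | inj₂ 1≤0 = order.≤-respʳ-≈ eq (*-nonneg 0≤-1 0≤-1)
      where
      0≤-1 : 0# ≤ - 1#
      0≤-1 = order.≤-respʳ-≈ (ring.+-identityˡ (- 1#)) (x≤y⇒0≤y-x 1≤0)
      eq : - 1# * - 1# ≈ 1#
      eq = ring.trans (ringP.-1*x≈-x (- 1#)) (ringP.-‿involutive 1#)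

    1≤y⇒y≤y² : ∀ {y} → 1# ≤ y → y ≤ y * y
    1≤y⇒y≤y² {y} 1≤y = 0≤y-x⇒x≤y (order.≤-respʳ-≈ eq
      (*-nonneg (x≤y⇒0≤y-x 1≤y) (order.trans 0≤1 1≤y)))
      where
      eq : (y - 1#) * y ≈ y * y - y
      eq = ring.trans (ring.distribʳ y y (- 1#)) (ring.+-congˡ (ringP.-1*x≈-x y))

    y²≤b⇒y≤1⊔b : ∀ b y → y * y ≤ b → y ≤ 1# ⊔ b
    y²≤b⇒y≤1⊔b b y y²≤b with order.total y 1#
    ... | inj₁ y≤1 = order.trans y≤1 (x≤x⊔y 1# b)
    ... | inj₂ 1≤y = order.trans (1≤y⇒y≤y² 1≤y) (order.trans y²≤b (x≤y⊔x 1# b))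

    0²≤x⊔0 : ∀ x → 0# * 0# ≤ x ⊔ 0#
    0²≤x⊔0 x = order.≤-respˡ-≈ (ring.sym (ring.zeroˡ 0#)) (x≤y⊔x x 0#)

  √-supremum : ∀ x → ∃ (IsSupremum (λ y → y * y ≤ x ⊔ 0#))
  √-supremum x = complete _ (0# , 0²≤x⊔0 x) (1# ⊔ (x ⊔ 0#) , y²≤b⇒y≤1⊔b (x ⊔ 0#))

  -- sup { y | y² ≤ max x 0 }: the nonnegative square root when x ≥ 0, and 0 otherwise.
  √ : Carrier → Carrier
  √ x = proj₁ (√-supremum x)

module ProjectionGames {ℓ} (ℝ : CompleteOrderedField ℓ) where
  open CompleteOrderedField ℝ

  sum-syntax : ∀ n → (Fin n → Carrier) → Carrier
  sum-syntax n f = sum f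

  infix 5 sum-syntax
  syntax sum-syntax n (λ i → x) = ∑[ i < n ] x

  -- The vertex sets, the alphabet and the set of edges are Fin #U, Fin #V, Fin #Σ
  -- and Fin #E; parallel edges are allowed, and constraint e α β ≡ true means
  -- that (α , β) belongs to the constraint of e.
  record ProjectionGame : Set ℓ where
    field
      #U #V #Σ #E : ℕ
      source      : Fin #E → Fin #U
      target      : Fin #E → Fin #V
      constraint  : Fin #E → Fin #Σ → Fin #Σ → Bool
      projection  : ∀ e α α′ β → constraint e α β ≡ true →
                    constraint e α′ β ≡ true → α ≡ α′
      weight      : Fin #E → Carrier
      weight≥0    : ∀ e → 0# ≤ weight e

    totalWeight : Carrier
    totalWeight = ∑[ e < #E ] weight e

    prob : Fin #E → Carrier
    prob e = weight e / totalWeight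

    μU : Fin #U → Carrier
    μU u = ∑[ e < #E ] (if does (source e ≟ u) then prob e else 0#)

    μV : Fin #V → Carrier
    μV v = ∑[ e < #E ] (if does (target e ≟ v) then prob e else 0#)

    field
      totalWeight>0 : 0# < totalWeight
      μU>0          : ∀ u → 0# < μU u
      μV>0          : ∀ v → 0# < μV v

  module _ (G : ProjectionGame) where
    open ProjectionGame G

    𝔼U : (Fin #U → Carrier) → Carrier
    𝔼U X = ∑[ u < #U ] μU u * X u

    𝔼V : (Fin #V → Carrier) → Carrier
    𝔼V X = ∑[ v < #V ] μV v * X v

    -- Expectation over (v , π) | u; a random variable is a function of the edge.
    𝔼∣ : Fin #U → (Fin #E → Carrier) → Carrier
    𝔼∣ u X = (∑[ e < #E ] (if does (source e ≟ u) then prob e * X e else 0#)) / μU u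

    apply : (Fin #V → Fin #Σ → Carrier) → (Fin #U → Fin #Σ → Carrier)
    apply f u α = 𝔼∣ u (λ e → ∑[ β < #Σ ]
      (if constraint e α β then f (target e) β else 0#))

    normU : (Fin #U → Fin #Σ → Carrier) → Carrier
    normU g = √ (𝔼U (λ u → ∑[ α < #Σ ] g u α * g u α))

    -- ‖Th‖
    normT : (Fin #V → Fin #Σ → Carrier) → Carrier
    normT h = √ (𝔼V (λ v → (∑[ β < #Σ ] h v β) * (∑[ β < #Σ ] h v β)))

    Nonnegative : (Fin #V → Fin #Σ → Carrier) → Set ℓ
    Nonnegative f = ∀ v β → 0# ≤ f v β

    IsAssignment : (Fin #V → Fin #Σ → Carrier) → Set ℓ
    IsAssignment f = Nonnegative f × (∀ v → ∑[ β < #Σ ] f v β ≈ 1#)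

    IsCollisionValue : Carrier → Set ℓ
    IsCollisionValue = IsMaximum λ x →
      ∃[ f ] IsAssignment f × x ≈ normU (apply f)

    Isλ₊ : Carrier → Set ℓ
    Isλ₊ = IsMaximum λ x →
      ∃[ h ] Nonnegative h × ¬ (normT h ≈ 0#) × x ≈ normU (apply h) / normT h

    condProb : Fin #U → Fin #V → Carrier
    condProb u v = 𝔼∣ u (λ e → if does (target e ≟ v) then 1# else 0#)

    pairProb : Fin #V → Fin #V → Carrier
    pairProb v₁ v₂ = 𝔼U (λ u → condProb u v₁ * condProb u v₂)

    A : Fin #V → Fin #V → Carrier
    A v₁ v₂ = pairProb v₁ v₂ / (∑[ v < #V ] pairProb v₁ v)

    ⟨_,_⟩ : (Fin #V → Carrier) → (Fin #V → Carrier) → Carrier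
    ⟨ f , g ⟩ = 𝔼V (λ v → f v * g v)

    -- λs zero ≥ λs (suc zero) ≥ … are the eigenvalues, with multiplicity, of A,
    -- a self-adjoint operator for ⟨_,_⟩: the i-th one belongs to the i-th member
    -- of some orthonormal basis of eigenvectors.  Such a list always exists
    -- and is unique, by the spectral theorem.
    record IsSpectrum (λs : Fin #V → Carrier) : Set ℓ where
      field
        decreasing : ∀ {i j} → i Fin.≤ j → λs j ≤ λs i
        vec        : Fin #V → Fin #V → Carrier
        orthonorm  : ∀ i j → ⟨ vec i , vec j ⟩ ≈ (if does (i ≟ j) then 1# else 0#)
        spanning   : ∀ (f : Fin #V → Carrier) →
                     Σ[ a ∈ (Fin #V → Carrier) ] (∀ v → f v ≈ (∑[ i < #V ] a i * vec i v))
        eigen      : ∀ i v → (∑[ v′ < #V ] A v v′ * vec i v′) ≈ λs i * vec i v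

  -- max (|λ₂|, |λₙ|).  When n = 1 there is no second eigenvalue, and this is
  -- the maximum over the empty set of nontrivial eigenvalues, taken to be 0.
  nontrivialMax : ∀ {n} → (Fin n → Carrier) → Carrier
  nontrivialMax {zero}        λs = 0#
  nontrivialMax {suc zero}    λs = 0#
  nontrivialMax {suc (suc n)} λs = ∣ λs (suc zero) ∣ ⊔ ∣ λs (fromℕ (suc n)) ∣

  IsExpanding : Carrier → ProjectionGame → Set ℓ
  IsExpanding γ G = ∃[ λs ] IsSpectrum G λs × γ ≤ 1# - nontrivialMax λs

{-# OPTIONS --safe #-}

-- Let h be optimal for λ₊, w v = Σ_β h v β, and let f = h / w be the assignment
-- obtained by normalising h.  Write K(e , e′) ∈ [0 , 1] for the agreement
-- Σ_α of the projections of f along two edges drawn independently at a common u,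
-- so that ‖Gf‖² = 𝔼 K, ‖Gh‖² = 𝔼 w w′ K and ⟨ w , A w ⟩ = 𝔼 w w′.  As K ≤ 1,
-- ‖Gh‖² ≤ ⟨ w , A w ⟩, and the spectral gap bounds the latter by ‖Th‖² - γ ‖w - c‖²,
-- where c is the projection of w to the constants; so ‖w - c‖² = O(ε / γ) ‖Th‖².
-- Finally c² ≤ 2 w w′ + (w - c)² + (w′ - c)² pointwise; multiplying by 1 - K and
-- averaging gives c² (1 - ‖Gf‖²) ≤ 2 (⟨ w , A w ⟩ - ‖Gh‖²) + 2 ‖w - c‖².

module Submission where

open import Algebra.Bundles using (CommutativeRing)
import Algebra.Construct.NaturalChoice.Max as NaturalMax
import Algebra.Properties.Ring as RingProperties
import Algebra.Properties.Semiring.Mult.TCOptimised as SemiringMult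
import Algebra.Properties.Semiring.Sum as SemiringSum
import Algebra.Solver.Ring as RingSolver
import Algebra.Solver.Ring.AlmostCommutativeRing as ACR
open import Data.Bool.Base using (Bool; true; false; if_then_else_)
open import Data.Empty using (⊥)
open import Data.Fin.Base as Fin using (Fin; zero; suc)
open import Data.Fin.Properties using (_≟_; suc-injective)
open import Data.Integer.Base as ℤ using (ℤ; +_; -[1+_]; +0)
import Data.Integer.Properties as ℤ
open import Data.Maybe.Base as Maybe using (Maybe)
open import Data.Nat.Base as ℕ using (ℕ; zero; suc; z≤n; s≤s)
import Data.Nat.Properties as ℕ
open import Data.Product.Base using (∃-syntax; Σ-syntax; _×_; _,_; proj₁; proj₂)
import Data.Sign.Base as Sign
open import Data.Sum.Base using (inj₁; inj₂)
open import Function.Base using (_∘_)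
open import Level using (Level)
open import Relation.Binary.Consequences using (dec⇒weaklyDec)
import Relation.Binary.Construct.NonStrictToStrict as ToStrict
open import Relation.Binary.PropositionalEquality.Core as ≡ using (_≡_)
import Relation.Binary.Reasoning.Setoid as SetoidReasoning
open import Relation.Nullary using (¬_; yes; no; contradiction; does)
open import Defs

-- The conclusion is trivial once `16 ε > γ`, and arguing by contradiction spares that case split.
-- Put ρ = 16 ε / γ and suppose ‖G‖ ≤ 1 - ρ. As ‖Gf‖² lies in [0 , 1], it is at most ‖Gf‖ ≤ ‖G‖, so
-- ρ ≤ 1 and hence 16 ε ≤ γ ≤ 1; only then is 1 - ε nonnegative, so that ‖Gh‖ > (1 - ε) ‖Th‖ may be
-- squared. The same comparison of ‖Gf‖² with ‖Gf‖ lets the whole estimate run on squared norms.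
--
-- The constant is 16 = 2 · 8. Squaring costs 2 ε, so ‖Th‖² - ‖Gh‖² < (γ ρ / 8) ‖Th‖², and the
-- spectral gap turns this into ‖w - c‖² < (ρ / 8) ‖Th‖². Replacing c² by ‖Th‖² - ‖w - c‖² in the
-- last inequality gives ρ ‖Th‖² ≤ 2 (‖Th‖² - ‖Gh‖²) + 3 ‖w - c‖², which is below (2 γ + 3) / 8 ≤ 5
-- / 8 of ρ ‖Th‖²: a contradiction. Any constant above 10 would leave room.

-- Integer coefficients for the ring solver.

module IntegerCoefficients {c ℓ : Level} (R : CommutativeRing c ℓ) where
  open CommutativeRing R
  open RingProperties ring
  open SemiringMult semiring using (1+×; ×-homo-+; ×1-homo-*) renaming (_×_ to _·_)
  open SetoidReasoning setoid

  -- The canonical ring map from the integers. With the optimised multiples `⟦ + 0 ⟧` and `⟦ + 1 ⟧`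
  -- reduce to `0#` and `1#`, so solver constants match the field's own.
  ⟦_⟧ : ℤ → Carrier
  ⟦ + n      ⟧ = n · 1#
  ⟦ -[1+ n ] ⟧ = - (suc n · 1#)

  suc-cancel : ∀ a b → (1# + a) + - (1# + b) ≈ a + - b
  suc-cancel a b = begin
    (1# + a) + - (1# + b)      ≈⟨ +-cong (+-comm 1# a) (sym (-‿+-comm 1# b)) ⟩
    (a + 1#) + (- 1# + - b)    ≈⟨ +-assoc a 1# _ ⟩
    a + (1# + (- 1# + - b))    ≈⟨ +-congˡ (sym (+-assoc 1# (- 1#) (- b))) ⟩
    a + ((1# + - 1#) + - b)    ≈⟨ +-congˡ (+-congʳ (-‿inverseʳ 1#)) ⟩
    a + (0# + - b)             ≈⟨ +-congˡ (+-identityˡ (- b)) ⟩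
    a + - b                    ∎

  ⊖-homo : ∀ m n → ⟦ m ℤ.⊖ n ⟧ ≈ m · 1# + - (n · 1#)
  ⊖-homo zero    zero    = sym (-‿inverseʳ 0#)
  ⊖-homo zero    (suc n) = sym (+-identityˡ _)
  ⊖-homo (suc m) zero    = sym (trans (+-congˡ -0#≈0#) (+-identityʳ _))
  ⊖-homo (suc m) (suc n) = begin
    ⟦ suc m ℤ.⊖ suc n ⟧                  ≡⟨ ≡.cong ⟦_⟧ (ℤ.[1+m]⊖[1+n]≡m⊖n m n) ⟩
    ⟦ m ℤ.⊖ n ⟧                          ≈⟨ ⊖-homo m n ⟩
    m · 1# + - (n · 1#)                  ≈⟨ suc-cancel _ _ ⟨
    (1# + m · 1#) + - (1# + n · 1#)      ≈⟨ +-cong (1+× m 1#) (-‿cong (1+× n 1#)) ⟨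
    suc m · 1# + - (suc n · 1#)          ∎

  +-homo : ∀ i j → ⟦ i ℤ.+ j ⟧ ≈ ⟦ i ⟧ + ⟦ j ⟧
  +-homo (+ m)    (+ n)    = ×-homo-+ 1# m n
  +-homo (+ m)    -[1+ n ] = ⊖-homo m (suc n)
  +-homo -[1+ m ] (+ n)    = trans (⊖-homo n (suc m)) (+-comm _ _)
  +-homo -[1+ m ] -[1+ n ] = begin
    - (suc (suc (m ℕ.+ n)) · 1#)      ≡⟨ ≡.cong (λ k → - (suc k · 1#)) (ℕ.+-suc m n) ⟨
    - ((suc m ℕ.+ suc n) · 1#)        ≈⟨ -‿cong (×-homo-+ 1# (suc m) (suc n)) ⟩
    - (suc m · 1# + suc n · 1#)       ≈⟨ -‿+-comm _ _ ⟨
    - (suc m · 1#) + - (suc n · 1#)   ∎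

  +◃-homo : ∀ n → ⟦ Sign.+ ℤ.◃ n ⟧ ≈ n · 1#
  +◃-homo zero    = refl
  +◃-homo (suc n) = refl

  -◃-homo : ∀ n → ⟦ Sign.- ℤ.◃ n ⟧ ≈ - (n · 1#)
  -◃-homo zero    = sym -0#≈0#
  -◃-homo (suc n) = refl

  *-homo : ∀ i j → ⟦ i ℤ.* j ⟧ ≈ ⟦ i ⟧ * ⟦ j ⟧
  *-homo (+ m)    (+ n)    = trans (+◃-homo (m ℕ.* n)) (×1-homo-* m n)
  *-homo (+ m)    -[1+ n ] = begin
    ⟦ Sign.- ℤ.◃ m ℕ.* suc n ⟧   ≈⟨ -◃-homo (m ℕ.* suc n) ⟩
    - ((m ℕ.* suc n) · 1#)       ≈⟨ -‿cong (×1-homo-* m (suc n)) ⟩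
    - ((m · 1#) * (suc n · 1#))  ≈⟨ -‿distribʳ-* _ _ ⟩
    (m · 1#) * - (suc n · 1#)    ∎
  *-homo -[1+ m ] (+ n)    = begin
    ⟦ Sign.- ℤ.◃ suc m ℕ.* n ⟧   ≈⟨ -◃-homo (suc m ℕ.* n) ⟩
    - ((suc m ℕ.* n) · 1#)       ≈⟨ -‿cong (×1-homo-* (suc m) n) ⟩
    - ((suc m · 1#) * (n · 1#))  ≈⟨ -‿distribˡ-* _ _ ⟩
    - (suc m · 1#) * (n · 1#)    ∎
  *-homo -[1+ m ] -[1+ n ] = begin
    (suc m ℕ.* suc n) · 1#             ≈⟨ ×1-homo-* (suc m) (suc n) ⟩
    (suc m · 1#) * (suc n · 1#)        ≈⟨ -x*-y≈x*y _ _ ⟨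
    - (suc m · 1#) * - (suc n · 1#)    ∎
    where
    -x*-y≈x*y : ∀ x y → - x * - y ≈ x * y
    -x*-y≈x*y x y = trans (sym (-‿distribˡ-* x (- y)))
      (trans (-‿cong (sym (-‿distribʳ-* x y))) (-‿involutive _))

  -‿homo : ∀ i → ⟦ ℤ.- i ⟧ ≈ - ⟦ i ⟧
  -‿homo (+ zero)  = sym -0#≈0#
  -‿homo (+ suc n) = refl
  -‿homo -[1+ n ]  = sym (-‿involutive _)

  ℤ⟶R : ℤ.+-*-rawRing ACR.-Raw-AlmostCommutative⟶ ACR.fromCommutativeRing R
  ℤ⟶R = record
    { ⟦_⟧    = ⟦_⟧
    ; +-homo = +-homo
    ; *-homo = *-homo
    ; -‿homo = -‿homo
    ; 0-homo = refl
    ; 1-homo = refl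
    }

  -- The solver cancels terms by comparing coefficients, and integer literals compare by
  -- computation, which elements of an abstract field do not.
  coeff≟ : ∀ i j → Maybe (⟦ i ⟧ ≈ ⟦ j ⟧)
  coeff≟ i j = Maybe.map (λ { ≡.refl → refl }) (dec⇒weaklyDec ℤ._≟_ i j)

  open RingSolver ℤ.+-*-rawRing (ACR.fromCommutativeRing R) ℤ⟶R coeff≟ public
    using (solve; con; _:+_; _:*_; _:-_; :-_; _:=_)

-- Ordered-field arithmetic and square roots.

module OrderedField {ℓ : Level} (ℝ : CompleteOrderedField ℓ) where
  open CompleteOrderedField ℝ
  open ring using (refl; sym; trans; +-congˡ; +-congʳ; *-congˡ; *-congʳ; *-identityˡ;
    *-identityʳ; zeroˡ; zeroʳ; -‿inverseʳ; -‿cong; +-identityˡ; +-identityʳ; +-comm)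
  open RingProperties ring.ring
  open IntegerCoefficients commutativeRing using (⟦_⟧; solve; con; _:+_; _:*_; _:-_; :-_; _:=_)
  open NaturalMax totalOrder using (x≤x⊔y; x≤y⊔x)

  infixl 8 _²
  _² : Carrier → Carrier
  x ² = x * x

  x≤y⇒0≤y-x : ∀ {x y} → x ≤ y → 0# ≤ y - x
  x≤y⇒0≤y-x {x} x≤y = order.≤-respˡ-≈ (-‿inverseʳ x) (+-monoˡ-≤ (- x) x≤y)

  -- The standard form of an inequality proof below: exhibit the slack `d` as a visibly nonnegative
  -- expression and leave the identity to the ring solver.
  x+d≈y⇒x≤y : ∀ {x y d} → 0# ≤ d → x + d ≈ y → x ≤ y
  x+d≈y⇒x≤y {x} {y} {d} 0≤d eq = order.≤-respʳ-≈ (trans (+-comm d x) eq)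
    (order.≤-respˡ-≈ (+-identityˡ x) (+-monoˡ-≤ x 0≤d))

  0≤y-x⇒x≤y : ∀ {x y} → 0# ≤ y - x → x ≤ y
  0≤y-x⇒x≤y {x} {y} 0≤d = x+d≈y⇒x≤y 0≤d (solve 2 (λ x y → x :+ (y :- x) := y) refl x y)

  +-mono-≤ : ∀ {a b c d} → a ≤ b → c ≤ d → a + c ≤ b + d
  +-mono-≤ {a} {b} {c} {d} a≤b c≤d = order.trans (+-monoˡ-≤ c a≤b)
    (order.≤-respˡ-≈ (+-comm c b) (order.≤-respʳ-≈ (+-comm d b) (+-monoˡ-≤ b c≤d)))

  +-nonneg : ∀ {x y} → 0# ≤ x → 0# ≤ y → 0# ≤ x + y
  +-nonneg 0≤x 0≤y = order.≤-respˡ-≈ (+-identityˡ 0#) (+-mono-≤ 0≤x 0≤y)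

  *-monoˡ-≤ : ∀ {x y z} → 0# ≤ z → x ≤ y → z * x ≤ z * y
  *-monoˡ-≤ {x} {y} {z} 0≤z x≤y = 0≤y-x⇒x≤y
    (order.≤-respʳ-≈ (solve 3 (λ x y z → z :* (y :- x) := z :* y :- z :* x) refl x y z)
      (*-nonneg 0≤z (x≤y⇒0≤y-x x≤y)))

  0≤x² : ∀ x → 0# ≤ x ²
  0≤x² x with order.total 0# x
  ... | inj₁ 0≤x = *-nonneg 0≤x 0≤x
  ... | inj₂ x≤0 = order.≤-respʳ-≈
    (solve 1 (λ x → (con +0 :- x) :* (con +0 :- x) := x :* x) refl x) (*-nonneg 0≤-x 0≤-x)
    where
    0≤-x : 0# ≤ 0# - x
    0≤-x = x≤y⇒0≤y-x x≤0

  0≤1 : 0# ≤ 1#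
  0≤1 = order.≤-respʳ-≈ (*-identityˡ 1#) (0≤x² 1#)

  0<1 : 0# < 1#
  0<1 = 0≤1 , 0≉1

  0≤n : ∀ n → 0# ≤ ⟦ + n ⟧
  0≤n zero          = order.refl
  0≤n (suc zero)    = 0≤1
  0≤n (suc (suc n)) = +-nonneg (0≤n (suc n)) 0≤1

  0<n : ∀ n → 0# < ⟦ + suc n ⟧
  0<n zero    = 0<1
  0<n (suc n) = order.trans (0≤n (suc n)) lem ,
    λ 0≈ → 0≉1 (order.antisym 0≤1 (order.trans
      (x+d≈y⇒x≤y (0≤n (suc n)) (+-comm 1# _)) (order.reflexive (sym 0≈))))
    where
    lem : ⟦ + suc n ⟧ ≤ ⟦ + suc (suc n) ⟧
    lem = x+d≈y⇒x≤y 0≤1 refl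

  <⇒≱ : ∀ {x y} → x < y → ¬ (y ≤ x)
  <⇒≱ = ToStrict.<⇒≱ _≈_ _≤_ order.antisym

  ≰⇒> : ∀ {x y} → ¬ (x ≤ y) → y < x
  ≰⇒> = ToStrict.≰⇒> _≈_ _≤_ sym order.reflexive order.total

  ≤-<-trans : ∀ {x y z} → x ≤ y → y < z → x < z
  ≤-<-trans = ToStrict.≤-<-trans _≈_ _≤_ order.trans order.antisym order.≤-respˡ-≈

  <-≤-trans : ∀ {x y z} → x < y → y ≤ z → x < z
  <-≤-trans = ToStrict.<-≤-trans _≈_ _≤_ sym order.trans order.antisym order.≤-respʳ-≈

  <-respʳ-≈ : ∀ {x y z} → y ≈ z → x < y → x < z
  <-respʳ-≈ = ToStrict.<-respʳ-≈ _≈_ _≤_ sym trans order.≤-respʳ-≈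

  x*y≈0⇒y≈0 : ∀ {x y} → ¬ (x ≈ 0#) → x * y ≈ 0# → y ≈ 0#
  x*y≈0⇒y≈0 {x} {y} x≉0 xy≈0 with inverse x x≉0
  ... | x⁻¹ , xx⁻¹≈1 = trans (sym (*-identityˡ y)) (trans (*-congʳ (sym xx⁻¹≈1))
    (trans (solve 3 (λ x i y → x :* i :* y := i :* (x :* y)) refl x x⁻¹ y)
      (trans (*-congˡ xy≈0) (zeroʳ x⁻¹))))

  x<y⇒0<y-x : ∀ {x y} → x < y → 0# < y - x
  x<y⇒0<y-x {x} {y} (x≤y , x≉y) = x≤y⇒0≤y-x x≤y , λ 0≈ → x≉y
    (trans (sym (+-identityʳ x)) (trans (+-congˡ 0≈) (solve 2 (λ x y → x :+ (y :- x) := y) refl x y)))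

  *-pos : ∀ {x y} → 0# < x → 0# < y → 0# < x * y
  *-pos (0≤x , 0≉x) (0≤y , 0≉y) = *-nonneg 0≤x 0≤y ,
    λ 0≈xy → 0≉y (sym (x*y≈0⇒y≈0 (λ x≈0 → 0≉x (sym x≈0)) (sym 0≈xy)))

  +-pos-nonneg : ∀ {x y} → 0# < x → 0# ≤ y → 0# < x + y
  +-pos-nonneg {x} {y} 0<x 0≤y = <-≤-trans 0<x (x+d≈y⇒x≤y 0≤y refl)

  0<x⇒x≉0 : ∀ {x} → 0# < x → ¬ (x ≈ 0#)
  0<x⇒x≉0 (_ , 0≉x) x≈0 = 0≉x (sym x≈0)

  *-cancelˡ : ∀ {x y z} → ¬ (x ≈ 0#) → x * y ≈ x * z → y ≈ z
  *-cancelˡ {x} {y} {z} x≉0 eq = trans (solve 2 (λ y z → y := (y :- z) :+ z) refl y z)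
    (trans (+-congʳ (x*y≈0⇒y≈0 x≉0
      (trans (solve 3 (λ x y z → x :* (y :- z) := x :* y :- x :* z) refl x y z)
        (trans (+-congʳ eq) (-‿inverseʳ _)))))
      (+-identityˡ z))

  *-cancelˡ-nonneg : ∀ {x y} → 0# < x → 0# ≤ x * y → 0# ≤ y
  *-cancelˡ-nonneg {x} {y} 0<x 0≤xy with order.total 0# y
  ... | inj₁ 0≤y = 0≤y
  ... | inj₂ y≤0 = order.reflexive (sym (x*y≈0⇒y≈0 (0<x⇒x≉0 0<x)
    (order.antisym (order.≤-respʳ-≈ (zeroʳ x) (*-monoˡ-≤ (proj₁ 0<x) y≤0)) 0≤xy)))

  *-cancelˡ-≤ : ∀ {x y z} → 0# < z → z * x ≤ z * y → x ≤ y
  *-cancelˡ-≤ {x} {y} {z} 0<z le = 0≤y-x⇒x≤y (*-cancelˡ-nonneg 0<z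
    (order.≤-respʳ-≈ (solve 3 (λ x y z → z :* y :- z :* x := z :* (y :- x)) refl x y z)
      (x≤y⇒0≤y-x le)))

  -- Quotients are handled only through this equation: facts about them are proved by clearing
  -- denominators with the cancellation lemmas above.
  *-/-cancel : ∀ x {y} → ¬ (y ≈ 0#) → y * (x / y) ≈ x
  *-/-cancel x {y} y≉0 with y order.≟ 0#
  ... | yes y≈0 = contradiction y≈0 y≉0
  ... | no  y≉0′ with inverse y y≉0′
  ...   | i , yi≈1 = trans (solve 3 (λ x y i → y :* (x :* i) := x :* (y :* i)) refl x y i)
    (trans (*-congˡ yi≈1) (*-identityʳ x))

  0≤∣x∣ : ∀ x → 0# ≤ ∣ x ∣
  0≤∣x∣ x with order.total 0# x
  ... | inj₁ 0≤x = order.trans 0≤x (x≤x⊔y x (- x))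
  ... | inj₂ x≤0 = order.trans (order.≤-respʳ-≈ (+-identityˡ (- x)) (x≤y⇒0≤y-x x≤0))
    (x≤y⊔x x (- x))

  -- If y < x, both factors of x² - y² = (x - y) (x + y) are positive, the second because it equals
  -- (x - y) + 2 y.
  square-cancel-≤ : ∀ {x y} → 0# ≤ y → x ² ≤ y ² → x ≤ y
  square-cancel-≤ {x} {y} 0≤y x²≤y² with x order.≤? y
  ... | yes x≤y = x≤y
  ... | no  x≰y = contradiction x²≤y² (<⇒≱ (≤-<-trans (order.reflexive (sym (+-identityˡ _))) y²<x²))
    where
    y<x = ≰⇒> x≰y
    0<d : 0# < (x - y) * (x + y)
    0<d = *-pos (x<y⇒0<y-x y<x)
      (<-respʳ-≈ (solve 2 (λ x y → (x :- y) :+ (y :+ y) := x :+ y) refl x y)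
        (+-pos-nonneg (x<y⇒0<y-x y<x) (+-nonneg 0≤y 0≤y)))
    y²<x² : 0# + y ² < x ²
    y²<x² = ≰⇒> λ x²≤0+y² → <⇒≱ 0<d (0≤y-x⇒x≤y (order.≤-respʳ-≈
      (solve 2 (λ x y → (con +0 :+ y :* y) :- x :* x := con +0 :- (x :- y) :* (x :+ y)) refl x y)
      (x≤y⇒0≤y-x x²≤0+y²)))

  √-upper : ∀ {x y} → y ² ≤ x → y ≤ √ x
  √-upper {x} {y} y²≤x = proj₁ (proj₂ (√-supremum x)) y (order.trans y²≤x (x≤x⊔y x 0#))

  √-least : ∀ {x b} → 0# ≤ x → (∀ y → y ² ≤ x → y ≤ b) → √ x ≤ b
  √-least {x} {b} 0≤x bound = proj₂ (proj₂ (√-supremum x)) b λ y y²≤x⊔0 → bound y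
    (order.trans y²≤x⊔0 x⊔0≤x)
    where
    x⊔0≤x : x ⊔ 0# ≤ x
    x⊔0≤x = NaturalMax.⊔-lub totalOrder order.refl 0≤x

  √-nonneg : ∀ {x} → 0# ≤ x → 0# ≤ √ x
  √-nonneg 0≤x = √-upper (order.≤-respˡ-≈ (sym (zeroˡ 0#)) 0≤x)

  -- If s² < x then s + d / (d + 2 s + 1), with d = x - s², still has square at most x.
  x≤√x² : ∀ {x} → 0# ≤ x → x ≤ (√ x) ²
  x≤√x² {x} 0≤x with x order.≤? (√ x) ²
  ... | yes x≤s² = x≤s²
  ... | no  x≰s² = contradiction s+δ≤s (<⇒≱ s<s+δ)
    where
    s = √ x
    d = x - s ²
    0≤s = √-nonneg 0≤x
    0<d : 0# < d
    0<d = x<y⇒0<y-x (≰⇒> x≰s²)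
    -- The summand `d` makes δ ≤ 1, so that δ (2 s + δ) ≤ δ (2 s + 1) ≤ m δ = d, which is the room
    -- between s² and x.
    m = d + (s + s + 1#)
    0<m : 0# < m
    0<m = +-pos-nonneg 0<d (+-nonneg (+-nonneg 0≤s 0≤s) 0≤1)
    δ = d / m
    mδ≈d : m * δ ≈ d
    mδ≈d = *-/-cancel d (0<x⇒x≉0 0<m)
    0≤δ : 0# ≤ δ
    0≤δ = *-cancelˡ-nonneg 0<m (order.≤-respʳ-≈ (sym mδ≈d) (proj₁ 0<d))
    δ≉0 : ¬ (δ ≈ 0#)
    δ≉0 δ≈0 = 0<x⇒x≉0 0<d (trans (sym mδ≈d) (trans (*-congˡ δ≈0) (zeroʳ m)))
    δ≤1 : δ ≤ 1#
    δ≤1 = *-cancelˡ-≤ 0<m (order.≤-respˡ-≈ (sym mδ≈d)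
      (x+d≈y⇒x≤y (+-nonneg (+-nonneg 0≤s 0≤s) 0≤1) (sym (*-identityʳ m))))
    [s+δ]²≤x : (s + δ) ² ≤ x
    [s+δ]²≤x = x+d≈y⇒x≤y
      (+-nonneg (*-nonneg 0≤δ (x≤y⇒0≤y-x δ≤1)) (*-nonneg (proj₁ 0<d) 0≤δ))
      (trans (solve 4 (λ s δ d x → (s :+ δ) :* (s :+ δ) :+ (δ :* (con (+ 1) :- δ) :+ d :* δ)
                := s :* s :+ (d :+ (s :+ s :+ con (+ 1))) :* δ) refl s δ d x)
        (trans (+-congˡ mδ≈d) (solve 2 (λ s x → s :* s :+ (x :- s :* s) := x) refl s x)))
    s+δ≤s : s + δ ≤ s
    s+δ≤s = √-upper [s+δ]²≤x
    s<s+δ : s < s + δ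
    s<s+δ = x+d≈y⇒x≤y 0≤δ refl , λ eq → δ≉0
      (trans (solve 2 (λ s δ → δ := (s :+ δ) :- s) refl s δ)
        (trans (+-congʳ (sym eq)) (-‿inverseʳ s)))

  -- If s² > x then the Newton iterate s - (s² - x) / 2 s is a smaller upper bound.
  √x²≤x : ∀ {x} → 0# ≤ x → (√ x) ² ≤ x
  √x²≤x {x} 0≤x with (√ x) ² order.≤? x
  ... | yes s²≤x = s²≤x
  ... | no  s²≰x = contradiction s≤t (<⇒≱ t<s)
    where
    s = √ x
    d = s ² - x
    0<d : 0# < d
    0<d = x<y⇒0<y-x (≰⇒> s²≰x)
    0<s : 0# < s
    0<s = √-nonneg 0≤x , λ 0≈s → <⇒≱ 0<d (order.≤-respˡ-≈
      (+-congʳ (sym (trans (*-congʳ (sym 0≈s)) (zeroˡ s))))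
      (order.≤-respˡ-≈ (sym (+-identityˡ (- x))) (0≤y-x⇒x≤y
        (order.≤-respʳ-≈ (solve 1 (λ x → x := con +0 :- (:- x)) refl x) 0≤x))))
    0<2s : 0# < s + s
    0<2s = +-pos-nonneg 0<s (proj₁ 0<s)
    δ = d / (s + s)
    2sδ≈d : (s + s) * δ ≈ d
    2sδ≈d = *-/-cancel d (0<x⇒x≉0 0<2s)
    t = s - δ
    0≤δ : 0# ≤ δ
    0≤δ = *-cancelˡ-nonneg 0<2s (order.≤-respʳ-≈ (sym 2sδ≈d) (proj₁ 0<d))
    δ≉0 : ¬ (δ ≈ 0#)
    δ≉0 δ≈0 = 0<x⇒x≉0 0<d (trans (sym 2sδ≈d) (trans (*-congˡ δ≈0) (zeroʳ _)))
    0≤t : 0# ≤ t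
    0≤t = *-cancelˡ-nonneg 0<2s (order.≤-respʳ-≈
      (trans (solve 2 (λ s x → s :* s :+ x := (s :+ s) :* s :- (s :* s :- x)) refl s x)
        (trans (+-congˡ (-‿cong (sym 2sδ≈d)))
          (solve 2 (λ s δ → (s :+ s) :* s :- (s :+ s) :* δ := (s :+ s) :* (s :- δ)) refl s δ)))
      (+-nonneg (0≤x² s) 0≤x))
    x≤t² : x ≤ t ²
    x≤t² = x+d≈y⇒x≤y (0≤x² δ)
      (trans (solve 3 (λ s x δ → x :+ δ :* δ := s :* s :- (s :* s :- x) :+ δ :* δ) refl s x δ)
        (trans (+-congʳ (+-congˡ (-‿cong (sym 2sδ≈d))))
          (solve 2 (λ s δ → s :* s :- (s :+ s) :* δ :+ δ :* δ := (s :- δ) :* (s :- δ)) refl s δ)))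
    s≤t : s ≤ t
    s≤t = √-least 0≤x λ y y²≤x → square-cancel-≤ 0≤t (order.trans y²≤x x≤t²)
    t<s : t < s
    t<s = x+d≈y⇒x≤y 0≤δ (solve 2 (λ s δ → (s :- δ) :+ δ := s) refl s δ) , λ eq → δ≉0
      (trans (solve 2 (λ s δ → δ := s :- (s :- δ)) refl s δ)
        (trans (+-congˡ (-‿cong eq)) (-‿inverseʳ s)))

  √² : ∀ {x} → 0# ≤ x → (√ x) ² ≈ x
  √² 0≤x = order.antisym (√x²≤x 0≤x) (x≤√x² 0≤x)

-- Finite sums and weighted means.

module WeightedSums {ℓ : Level} (ℝ : CompleteOrderedField ℓ) where
  open CompleteOrderedField ℝ
  open ring using (refl; sym; trans; setoid; +-cong; +-congˡ; *-congˡ; *-congʳ; *-comm;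
    *-identityˡ; *-identityʳ; zeroˡ; zeroʳ; +-identityˡ; +-identityʳ)
  open IntegerCoefficients commutativeRing using (solve; _:*_; _:=_)
  open OrderedField ℝ
  open SemiringSum ring.semiring using (∑-comm; ∑-distrib-+; *-distribˡ-sum; *-distribʳ-sum;
    sum-replicate-zero)
  open SetoidReasoning setoid

  sum-cong : ∀ {n} {f g : Fin n → Carrier} → (∀ i → f i ≈ g i) → sum f ≈ sum g
  sum-cong {zero}  f≈g = refl
  sum-cong {suc n} f≈g = +-cong (f≈g zero) (sum-cong (λ i → f≈g (suc i)))

  sum-mono : ∀ {n} {f g : Fin n → Carrier} → (∀ i → f i ≤ g i) → sum f ≤ sum g
  sum-mono {zero}  f≤g = order.refl
  sum-mono {suc n} f≤g = +-mono-≤ (f≤g zero) (sum-mono (λ i → f≤g (suc i)))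

  sum-zero : ∀ {n} {f : Fin n → Carrier} → (∀ i → f i ≈ 0#) → sum f ≈ 0#
  sum-zero {n} f≈0 = trans (sum-cong f≈0) (sum-replicate-zero n)

  sum-nonneg : ∀ {n} {f : Fin n → Carrier} → (∀ i → 0# ≤ f i) → 0# ≤ sum f
  sum-nonneg {n} 0≤f = order.≤-respˡ-≈ (sum-replicate-zero n) (sum-mono 0≤f)

  term≤sum : ∀ {n} {f : Fin n → Carrier} → (∀ i → 0# ≤ f i) → ∀ i → f i ≤ sum f
  term≤sum {suc n} 0≤f zero    = x+d≈y⇒x≤y (sum-nonneg (λ i → 0≤f (suc i))) refl
  term≤sum {suc n} 0≤f (suc i) = order.trans (term≤sum (λ j → 0≤f (suc j)) i)
    (x+d≈y⇒x≤y (0≤f zero) (ring.+-comm _ _))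

  sum-zero⇒zero : ∀ {n} {f : Fin n → Carrier} → (∀ i → 0# ≤ f i) → sum f ≈ 0# → ∀ i → f i ≈ 0#
  sum-zero⇒zero 0≤f eq i = order.antisym (order.≤-respʳ-≈ eq (term≤sum 0≤f i)) (0≤f i)

  if-cong : ∀ b {x y z} → x ≈ y → (if b then x else z) ≈ (if b then y else z)
  if-cong true  x≈y = x≈y
  if-cong false x≈y = refl

  *-if : ∀ b x y → x * (if b then y else 0#) ≈ (if b then x * y else 0#)
  *-if true  x y = refl
  *-if false x y = zeroʳ x

  if-* : ∀ b x y → (if b then x else 0#) * y ≈ (if b then x * y else 0#)
  if-* true  x y = refl
  if-* false x y = zeroˡ y

  if-nonneg : ∀ b {x} → 0# ≤ x → 0# ≤ (if b then x else 0#)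
  if-nonneg true  0≤x = 0≤x
  if-nonneg false 0≤x = order.refl

  if-≤ : ∀ b {x} → 0# ≤ x → (if b then x else 0#) ≤ x
  if-≤ true  0≤x = order.refl
  if-≤ false 0≤x = 0≤x

  sum-δ : ∀ {n} (i : Fin n) (x : Fin n → Carrier) →
          sum (λ j → if does (i ≟ j) then x j else 0#) ≈ x i
  sum-δ {suc n} zero    x = trans (+-congˡ (sum-replicate-zero n)) (+-identityʳ (x zero))
  sum-δ {suc n} (suc i) x = trans (+-identityˡ _) (trans (sum-cong shift) (sum-δ i (x ∘ suc)))
    where
    shift : ∀ j → (if does (suc i ≟ suc j) then x (suc j) else 0#) ≈
                  (if does (i ≟ j) then x (suc j) else 0#)
    shift j with i ≟ j
    ... | yes _ = refl
    ... | no  _ = refl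

  -- The form in which the projection property is applied: the mass of one β is counted for at most
  -- one α.
  sum-if-≤ : ∀ {n} (b : Fin n → Bool) → (∀ i j → b i ≡ true → b j ≡ true → i ≡ j) →
             ∀ {x} → 0# ≤ x → sum (λ i → if b i then x else 0#) ≤ x
  sum-if-≤ {zero}  b unique 0≤x = 0≤x
  sum-if-≤ {suc n} b unique {x} 0≤x with b zero in b₀
  ... | false = order.≤-respˡ-≈ (sym (+-identityˡ _))
    (sum-if-≤ (b ∘ suc) (λ i j bi bj → suc-injective (unique (suc i) (suc j) bi bj)) 0≤x)
  ... | true  = order.reflexive (trans (+-congˡ (sum-zero vanish)) (+-identityʳ x))
    where
    vanish : ∀ i → (if b (suc i) then x else 0#) ≈ 0#
    vanish i with b (suc i) in bᵢ
    ... | false = refl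
    ... | true  with unique zero (suc i) b₀ bᵢ
    ...   | ()

  -- The weights are neither normalised nor assumed nonnegative, so one set of lemmas serves
  -- probability measures, rows of a matrix and arbitrary functions as weights.
  mean : ∀ {n} → (Fin n → Carrier) → (Fin n → Carrier) → Carrier
  mean p X = sum (λ i → p i * X i)

  mean-cong : ∀ {n} (p : Fin n → Carrier) {X Y} → (∀ i → X i ≈ Y i) → mean p X ≈ mean p Y
  mean-cong p X≈Y = sum-cong λ i → *-congˡ (X≈Y i)

  mean-mono : ∀ {n} (p : Fin n → Carrier) {X Y} → (∀ i → 0# ≤ p i) → (∀ i → X i ≤ Y i) →
              mean p X ≤ mean p Y
  mean-mono p 0≤p X≤Y = sum-mono λ i → *-monoˡ-≤ (0≤p i) (X≤Y i)

  mean-nonneg : ∀ {n} (p : Fin n → Carrier) {X} → (∀ i → 0# ≤ p i) → (∀ i → 0# ≤ X i) →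
                0# ≤ mean p X
  mean-nonneg p 0≤p 0≤X = sum-nonneg λ i → *-nonneg (0≤p i) (0≤X i)

  mean-+ : ∀ {n} (p X Y : Fin n → Carrier) → mean p (λ i → X i + Y i) ≈ mean p X + mean p Y
  mean-+ p X Y = trans (sum-cong λ i → ring.distribˡ (p i) (X i) (Y i)) (∑-distrib-+ (λ i → p i * X i) (λ i → p i * Y i))

  mean-*ˡ : ∀ {n} (p : Fin n → Carrier) c X → mean p (λ i → c * X i) ≈ c * mean p X
  mean-*ˡ p c X = trans
    (sum-cong λ i → solve 3 (λ p c x → p :* (c :* x) := c :* (p :* x)) refl (p i) c (X i))
    (sym (*-distribˡ-sum c (λ i → p i * X i)))

  mean-*ʳ : ∀ {n} (p : Fin n → Carrier) X c → mean p (λ i → X i * c) ≈ mean p X * c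
  mean-*ʳ p X c = trans (mean-cong p λ i → *-comm (X i) c) (trans (mean-*ˡ p c X) (*-comm c _))

  mean-const : ∀ {n} (p : Fin n → Carrier) → sum p ≈ 1# → ∀ c → mean p (λ _ → c) ≈ c
  mean-const p p≈1 c = trans (sym (*-distribʳ-sum c p)) (trans (*-congʳ p≈1) (*-identityˡ c))

  mean-1 : ∀ {n} (p : Fin n → Carrier) → mean p (λ _ → 1#) ≈ sum p
  mean-1 p = sum-cong λ i → *-identityʳ (p i)

  mean-sum : ∀ {m n} (p : Fin m → Carrier) (X : Fin m → Fin n → Carrier) →
             mean p (λ i → sum (X i)) ≈ sum (λ j → mean p (λ i → X i j))
  mean-sum p X = trans (sum-cong λ i → *-distribˡ-sum (p i) (X i)) (∑-comm (λ i j → p i * X i j))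

  mean-comm : ∀ {m n} (p : Fin m → Carrier) (q : Fin n → Carrier) (X : Fin m → Fin n → Carrier) →
              mean p (λ i → mean q (X i)) ≈ mean q (λ j → mean p (λ i → X i j))
  mean-comm p q X = trans (mean-sum p (λ i j → q j * X i j))
    (sum-cong λ j → mean-*ˡ p (q j) (λ i → X i j))

  -- Independence of two draws from `p`; it turns the square of a conditional expectation into an
  -- expectation over pairs.
  mean-* : ∀ {n} (p X Y : Fin n → Carrier) →
           mean p (λ i → mean p (λ j → X i * Y j)) ≈ mean p X * mean p Y
  mean-* p X Y = trans (mean-cong p λ i → mean-*ˡ p (X i) Y) (mean-*ʳ p X (mean p Y))

-- The spectral gap in an orthonormal eigenbasis.

module SpectralGap {ℓ : Level} (ℝ : CompleteOrderedField ℓ) where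
  open CompleteOrderedField ℝ
  open ring using (refl; sym; trans; setoid; +-cong; +-congˡ; *-cong; *-congˡ; *-congʳ; *-comm;
    *-assoc; *-identityˡ; *-identityʳ; zeroˡ; +-identityˡ; +-identityʳ)
  open IntegerCoefficients commutativeRing using (solve; con; _:+_; _:*_; _:-_; :-_; _:=_)
  open OrderedField ℝ
  open WeightedSums ℝ
  open ProjectionGames ℝ using (nontrivialMax)
  open NaturalMax totalOrder using (x≤x⊔y)
  open SemiringSum ring.semiring using (*-distribˡ-sum; *-distribʳ-sum; ∑-distrib-+)
  open SetoidReasoning setoid

  nontrivialMax-nonneg : ∀ {n} (λs : Fin n → Carrier) → 0# ≤ nontrivialMax λs
  nontrivialMax-nonneg {zero}        λs = order.refl
  nontrivialMax-nonneg {suc zero}    λs = order.refl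
  nontrivialMax-nonneg {suc (suc n)} λs = order.trans (0≤∣x∣ (λs (suc zero))) (x≤x⊔y _ _)

  -- By the ordering every eigenvalue after the first is at most λ₂, hence at most |λ₂|.
  nontrivial≤nontrivialMax : ∀ {n} (λs : Fin (suc n) → Carrier) →
    (∀ {i j} → i Fin.≤ j → λs j ≤ λs i) → ∀ i → λs (suc i) ≤ nontrivialMax λs
  nontrivial≤nontrivialMax {suc n} λs decreasing i =
    order.trans (decreasing {suc zero} {suc i} (s≤s z≤n))
      (order.trans (x≤x⊔y _ _) (x≤x⊔y ∣ λs (suc zero) ∣ _))

  module _ {n : ℕ} (μ : Fin n → Carrier) (A : Fin n → Fin n → Carrier)
    (λs : Fin n → Carrier) (vec : Fin n → Fin n → Carrier)
    (orthonorm : ∀ i j → mean μ (λ v → vec i v * vec j v) ≈ (if does (i ≟ j) then 1# else 0#))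
    (eigen : ∀ i v → sum (λ v′ → A v v′ * vec i v′) ≈ λs i * vec i v)
    where

    comb : (Fin n → Carrier) → Fin n → Carrier
    comb a v = sum (λ i → a i * vec i v)

    -- Orthonormality reads a coefficient back as an inner product; uniqueness of coefficients and
    -- Parseval's identity both rest on this.
    comb-vec : ∀ a j → mean μ (λ v → comb a v * vec j v) ≈ a j
    comb-vec a j = begin
      mean μ (λ v → comb a v * vec j v)
        ≈⟨ mean-cong μ (λ v → *-comm (comb a v) (vec j v)) ⟩
      mean μ (λ v → vec j v * comb a v)
        ≈⟨ mean-cong μ (λ v → *-distribˡ-sum (vec j v) (λ i → a i * vec i v)) ⟩
      mean μ (λ v → sum (λ i → vec j v * (a i * vec i v)))
        ≈⟨ mean-sum μ (λ v i → vec j v * (a i * vec i v)) ⟩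
      sum (λ i → mean μ (λ v → vec j v * (a i * vec i v)))
        ≈⟨ sum-cong (λ i → trans
             (mean-cong μ λ v → solve 3 (λ x a y → x :* (a :* y) := a :* (x :* y)) refl
                                (vec j v) (a i) (vec i v))
             (mean-*ˡ μ (a i) (λ v → vec j v * vec i v))) ⟩
      sum (λ i → a i * mean μ (λ v → vec j v * vec i v))
        ≈⟨ sum-cong (λ i → trans (*-congˡ (orthonorm j i)) (*-if (does (j ≟ i)) (a i) 1#)) ⟩
      sum (λ i → if does (j ≟ i) then a i * 1# else 0#)
        ≈⟨ sum-δ j (λ i → a i * 1#) ⟩
      a j * 1#
        ≈⟨ *-identityʳ (a j) ⟩
      a j ∎

    comb-injective : ∀ {a b} → (∀ v → comb a v ≈ comb b v) → ∀ j → a j ≈ b j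
    comb-injective {a} {b} eq j = trans (sym (comb-vec a j))
      (trans (mean-cong μ λ v → *-congʳ (eq v)) (comb-vec b j))

    parseval : ∀ a b → mean μ (λ v → comb a v * comb b v) ≈ sum (λ i → a i * b i)
    parseval a b = begin
      mean μ (λ v → comb a v * comb b v)
        ≈⟨ mean-cong μ (λ v → *-distribˡ-sum (comb a v) (λ i → b i * vec i v)) ⟩
      mean μ (λ v → sum (λ i → comb a v * (b i * vec i v)))
        ≈⟨ mean-sum μ (λ v i → comb a v * (b i * vec i v)) ⟩
      sum (λ i → mean μ (λ v → comb a v * (b i * vec i v)))
        ≈⟨ sum-cong (λ i → trans
             (mean-cong μ λ v → solve 3 (λ x b y → x :* (b :* y) := (x :* y) :* b) refl
                                (comb a v) (b i) (vec i v))
             (mean-*ʳ μ (λ v → comb a v * vec i v) (b i))) ⟩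
      sum (λ i → mean μ (λ v → comb a v * vec i v) * b i)
        ≈⟨ sum-cong (λ i → *-congʳ (comb-vec a i)) ⟩
      sum (λ i → a i * b i) ∎

    apply-comb : ∀ a v → sum (λ v′ → A v v′ * comb a v′) ≈ comb (λ i → λs i * a i) v
    apply-comb a v = begin
      mean (A v) (comb a)
        ≈⟨ mean-sum (A v) (λ v′ i → a i * vec i v′) ⟩
      sum (λ i → mean (A v) (λ v′ → a i * vec i v′))
        ≈⟨ sum-cong (λ i → trans (mean-*ˡ (A v) (a i) (vec i)) (*-congˡ (eigen i v))) ⟩
      sum (λ i → a i * (λs i * vec i v))
        ≈⟨ sum-cong (λ i → solve 3 (λ a l x → a :* (l :* x) := (l :* a) :* x) refl
                             (a i) (λs i) (vec i v)) ⟩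
      comb (λ i → λs i * a i) v ∎

  -- The constant function 1 is fixed by A, hence is carried by the top
  -- eigenvector, and c is the projection of w to it.
  spectral-gap : ∀ {n} (μ : Fin n → Carrier) (A : Fin n → Fin n → Carrier) (λs : Fin n → Carrier)
    (vec : Fin n → Fin n → Carrier) →
    (∀ i j → mean μ (λ v → vec i v * vec j v) ≈ (if does (i ≟ j) then 1# else 0#)) →
    (∀ i v → sum (λ v′ → A v v′ * vec i v′) ≈ λs i * vec i v) →
    (∀ {i j} → i Fin.≤ j → λs j ≤ λs i) →
    (∀ (f : Fin n → Carrier) → Σ[ a ∈ (Fin n → Carrier) ] (∀ v → f v ≈ sum (λ i → a i * vec i v))) →
    sum μ ≈ 1# → (∀ v → sum (A v) ≈ 1#) →
    ∀ γ → 0# < γ → γ ≤ 1# - nontrivialMax λs → ∀ (w : Fin n → Carrier) →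
    ∃[ c ] mean μ (λ v → w v ²) ≈ c ² + mean μ (λ v → (w v - c) ²) ×
           mean μ (λ v → w v * sum (λ v′ → A v v′ * w v′)) + γ * mean μ (λ v → (w v - c) ²) ≤
             mean μ (λ v → w v ²)
  -- Without vertices the total mass 1 would be an empty sum.
  spectral-gap {zero} μ A λs vec _ _ _ _ 0≈1 _ = contradiction 0≈1 0≉1
  spectral-gap {suc n} μ A λs vec orthonorm eigen decreasing spanning μ≈1 A1≈1 γ 0<γ γ≤ w =
    c , Y≈c²+D , bound
    where
    comb′ = comb μ A λs vec orthonorm eigen
    parseval′ = parseval μ A λs vec orthonorm eigen
    a = proj₁ (spanning (λ _ → 1#))
    1≈ = proj₂ (spanning (λ _ → 1#))
    b = proj₁ (spanning w)
    w≈ = proj₂ (spanning w)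
    a₀ = a zero
    b₀ = b zero
    -- The top eigenvector is the constant a₀, which is 1 or -1, so the component b₀ · `vec zero` of
    -- w is the constant b₀ a₀, whichever sign the basis has chosen.
    c = b₀ * a₀

    -- Compare coefficients in A 1 = 1. Where the eigenvalue is not 1 the coefficient must vanish,
    -- and past the top it is at most 1 - γ < 1.
    λa≈a : ∀ i → λs i * a i ≈ a i
    λa≈a = comb-injective μ A λs vec orthonorm eigen λ v → begin
      comb′ (λ i → λs i * a i) v              ≈⟨ apply-comb μ A λs vec orthonorm eigen a v ⟨
      sum (λ v′ → A v v′ * comb′ a v′)        ≈⟨ mean-cong (A v) 1≈ ⟨
      sum (λ v′ → A v v′ * 1#)                ≈⟨ mean-1 (A v) ⟩
      sum (A v)                               ≈⟨ A1≈1 v ⟩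
      1#                                      ≈⟨ 1≈ v ⟩
      comb′ a v                               ∎

    λ≤1-γ : ∀ i → λs (suc i) ≤ 1# - γ
    λ≤1-γ i = order.trans (nontrivial≤nontrivialMax λs decreasing i)
      (0≤y-x⇒x≤y (order.≤-respʳ-≈
        (solve 2 (λ m g → (con (+ 1) :- m) :- g := (con (+ 1) :- g) :- m) refl _ γ)
        (x≤y⇒0≤y-x γ≤)))

    a≈0 : ∀ i → a (suc i) ≈ 0#
    a≈0 i = x*y≈0⇒y≈0 (0<x⇒x≉0 0<1-λ) (begin
      (1# - λs (suc i)) * a (suc i)          ≈⟨ solve 2 (λ l a → (con (+ 1) :- l) :* a := a :- l :* a)
                                                  refl (λs (suc i)) (a (suc i)) ⟩
      a (suc i) - λs (suc i) * a (suc i)     ≈⟨ +-congˡ (ring.-‿cong (λa≈a (suc i))) ⟩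
      a (suc i) - a (suc i)                  ≈⟨ ring.-‿inverseʳ _ ⟩
      0#                                     ∎)
      where
      0<1-λ : 0# < 1# - λs (suc i)
      0<1-λ = <-≤-trans 0<γ (0≤y-x⇒x≤y (order.≤-respʳ-≈
        (solve 2 (λ l g → (con (+ 1) :- g) :- l := (con (+ 1) :- l) :- g) refl _ γ)
        (x≤y⇒0≤y-x (λ≤1-γ i))))

    a₀²≈1 : a₀ ² ≈ 1#
    a₀²≈1 = begin
      a₀ ²                                   ≈⟨ +-identityʳ _ ⟨
      a₀ ² + 0#                              ≈⟨ +-congˡ (sum-zero λ i → trans (*-congʳ (a≈0 i)) (zeroˡ _)) ⟨
      sum (λ i → a i * a i)                  ≈⟨ parseval′ a a ⟨
      mean μ (λ v → comb′ a v * comb′ a v)   ≈⟨ mean-cong μ (λ v → *-cong (1≈ v) (1≈ v)) ⟨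
      mean μ (λ v → 1# * 1#)                 ≈⟨ mean-const μ μ≈1 (1# * 1#) ⟩
      1# * 1#                                ≈⟨ *-identityˡ 1# ⟩
      1#                                     ∎

    -- `IsSpectrum` does not state the top eigenvalue; it follows because a₀ is nonzero in λ₀ a₀ =
    -- a₀.
    λ₀≈1 : λs zero ≈ 1#
    λ₀≈1 = begin
      λs zero                  ≈⟨ *-identityʳ _ ⟨
      λs zero * 1#             ≈⟨ *-congˡ a₀²≈1 ⟨
      λs zero * (a₀ * a₀)      ≈⟨ *-assoc _ _ _ ⟨
      λs zero * a₀ * a₀        ≈⟨ *-congʳ (λa≈a zero) ⟩
      a₀ * a₀                  ≈⟨ a₀²≈1 ⟩
      1#                       ∎

    -- Coefficients of w - c. As 1 is carried by the top eigenvector, subtracting c clears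
    -- coordinate zero and leaves the others unchanged.
    d : Fin (suc n) → Carrier
    d i = b i - c * a i

    d₀≈0 : d zero ≈ 0#
    d₀≈0 = begin
      b₀ - b₀ * a₀ * a₀        ≈⟨ +-congˡ (ring.-‿cong (trans (*-assoc _ _ _) (*-congˡ a₀²≈1))) ⟩
      b₀ - b₀ * 1#             ≈⟨ solve 1 (λ b → b :- b :* con (+ 1) := con +0) refl b₀ ⟩
      0#                       ∎

    dᵢ≈bᵢ : ∀ i → d (suc i) ≈ b (suc i)
    dᵢ≈bᵢ i = trans (+-congˡ (ring.-‿cong (*-congˡ (a≈0 i))))
      (solve 2 (λ b c → b :- c :* con +0 := b) refl (b (suc i)) c)

    w-c≈ : ∀ v → w v - c ≈ comb′ d v
    w-c≈ v = begin
      w v - c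
        ≈⟨ solve 2 (λ w c → w :- c := w :+ (:- c) :* con (+ 1)) refl (w v) c ⟩
      w v + - c * 1#
        ≈⟨ +-cong (w≈ v) (*-congˡ (1≈ v)) ⟩
      comb′ b v + - c * comb′ a v
        ≈⟨ +-congˡ (*-distribˡ-sum (- c) (λ i → a i * vec i v)) ⟩
      comb′ b v + sum (λ i → - c * (a i * vec i v))
        ≈⟨ ∑-distrib-+ (λ i → b i * vec i v) (λ i → - c * (a i * vec i v)) ⟨
      sum (λ i → b i * vec i v + - c * (a i * vec i v))
        ≈⟨ sum-cong (λ i → solve 4 (λ b c a x → b :* x :+ (:- c) :* (a :* x) := (b :- c :* a) :* x)
             refl (b i) c (a i) (vec i v)) ⟩
      comb′ d v ∎

    B : Carrier
    B = sum (λ i → b (suc i) ²)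

    Y≈ : mean μ (λ v → w v ²) ≈ b₀ ² + B
    Y≈ = trans (mean-cong μ λ v → *-cong (w≈ v) (w≈ v)) (parseval′ b b)

    D≈ : mean μ (λ v → (w v - c) ²) ≈ B
    D≈ = begin
      mean μ (λ v → (w v - c) ²)             ≈⟨ mean-cong μ (λ v → *-cong (w-c≈ v) (w-c≈ v)) ⟩
      mean μ (λ v → comb′ d v * comb′ d v)   ≈⟨ parseval′ d d ⟩
      sum (λ i → d i * d i)                  ≈⟨ +-cong (trans (*-congʳ d₀≈0) (zeroˡ _))
                                                  (sum-cong λ i → *-cong (dᵢ≈bᵢ i) (dᵢ≈bᵢ i)) ⟩
      0# + B                                 ≈⟨ +-identityˡ B ⟩
      B                                      ∎

    c²≈b₀² : c ² ≈ b₀ ²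
    c²≈b₀² = begin
      c ²           ≈⟨ solve 2 (λ a b → (b :* a) :* (b :* a) := (b :* b) :* (a :* a)) refl a₀ b₀ ⟩
      b₀ ² * a₀ ²   ≈⟨ *-congˡ a₀²≈1 ⟩
      b₀ ² * 1#     ≈⟨ *-identityʳ _ ⟩
      b₀ ²          ∎

    Y≈c²+D : mean μ (λ v → w v ²) ≈ c ² + mean μ (λ v → (w v - c) ²)
    Y≈c²+D = trans Y≈ (sym (+-cong c²≈b₀² D≈))

    Q≈ : mean μ (λ v → w v * sum (λ v′ → A v v′ * w v′)) ≈
         b₀ ² + sum (λ i → b (suc i) ² * λs (suc i))
    Q≈ = begin
      mean μ (λ v → w v * sum (λ v′ → A v v′ * w v′))
        ≈⟨ mean-cong μ (λ v → *-cong (w≈ v) (trans (mean-cong (A v) w≈)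
             (apply-comb μ A λs vec orthonorm eigen b v))) ⟩
      mean μ (λ v → comb′ b v * comb′ (λ i → λs i * b i) v)
        ≈⟨ parseval′ b (λ i → λs i * b i) ⟩
      sum (λ i → b i * (λs i * b i))
        ≈⟨ +-cong (trans (*-congˡ (trans (*-congʳ λ₀≈1) (*-identityˡ b₀))) refl)
             (sum-cong λ i → solve 2 (λ b l → b :* (l :* b) := b :* b :* l) refl
               (b (suc i)) (λs (suc i))) ⟩
      b₀ ² + sum (λ i → b (suc i) ² * λs (suc i)) ∎

    bound : mean μ (λ v → w v * sum (λ v′ → A v v′ * w v′)) + γ * mean μ (λ v → (w v - c) ²) ≤
            mean μ (λ v → w v ²)
    -- Both sides contain b₀²; in every other coordinate λ b² ≤ (1 - γ) b², and the missing γ b² add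
    -- up to γ times the deviation.
    bound = order.≤-respˡ-≈ (sym (+-cong Q≈ (*-congˡ D≈)))
      (order.≤-respʳ-≈ (trans
          (solve 3 (λ x b g → (x :+ b :* (con (+ 1) :- g)) :+ g :* b := x :+ b) refl (b₀ ²) B γ)
          (sym Y≈))
        (+-monoˡ-≤ (γ * B) (+-mono-≤ order.refl
          (order.≤-respʳ-≈ (sym (*-distribʳ-sum (1# - γ) (λ i → b (suc i) ²)))
            (sum-mono λ i → *-monoˡ-≤ (0≤x² (b (suc i))) (λ≤1-γ i))))))

-- Expectations over edges and over pairs of edges of a game.

module GameMeans {ℓ : Level} (ℝ : CompleteOrderedField ℓ)
  (G : ProjectionGames.ProjectionGame ℝ) where
  open CompleteOrderedField ℝ
  open ring using (refl; sym; trans; setoid; *-cong; *-congˡ; *-congʳ; *-comm; *-assoc;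
    *-identityˡ; *-identityʳ)
  open IntegerCoefficients commutativeRing using (solve; _:*_; _:=_)
  open OrderedField ℝ
  open WeightedSums ℝ
  open ProjectionGames ℝ using (𝔼U; 𝔼∣; apply; condProb; pairProb; A; Nonnegative; IsAssignment)
  open ProjectionGames.ProjectionGame G
  open SemiringSum ring.semiring using (∑-comm; *-distribˡ-sum; *-distribʳ-sum)
  open SetoidReasoning setoid

  private
    T≉0 : ¬ (totalWeight ≈ 0#)
    T≉0 = 0<x⇒x≉0 totalWeight>0

    μU≉0 : ∀ u → ¬ (μU u ≈ 0#)
    μU≉0 u = 0<x⇒x≉0 (μU>0 u)

  prob-nonneg : ∀ e → 0# ≤ prob e
  prob-nonneg e = *-cancelˡ-nonneg totalWeight>0
    (order.≤-respʳ-≈ (sym (*-/-cancel (weight e) T≉0)) (weight≥0 e))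

  sum-prob : sum prob ≈ 1#
  sum-prob = *-cancelˡ T≉0 (begin
    totalWeight * sum prob               ≈⟨ *-distribˡ-sum totalWeight prob ⟩
    sum (λ e → totalWeight * prob e)     ≈⟨ sum-cong (λ e → *-/-cancel (weight e) T≉0) ⟩
    totalWeight                          ≈⟨ *-identityʳ totalWeight ⟨
    totalWeight * 1#                     ∎)

  probAt : Fin #U → Fin #E → Carrier
  probAt u e = if does (source e ≟ u) then prob e else 0#

  -- The law of an edge given its source, kept as a weight on all edges so that conditional
  -- expectations are instances of `mean`.
  cond : Fin #U → Fin #E → Carrier
  cond u e = probAt u e / μU u

  μU*cond : ∀ u e → μU u * cond u e ≈ probAt u e
  μU*cond u e = *-/-cancel (probAt u e) (μU≉0 u)

  cond-nonneg : ∀ u e → 0# ≤ cond u e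
  cond-nonneg u e = *-cancelˡ-nonneg (μU>0 u)
    (order.≤-respʳ-≈ (sym (μU*cond u e)) (if-nonneg (does (source e ≟ u)) (prob-nonneg e)))

  μU*mean : ∀ u X → μU u * mean (cond u) X ≈ mean (probAt u) X
  μU*mean u X = trans (*-distribˡ-sum (μU u) (λ e → cond u e * X e))
    (sum-cong λ e → trans (sym (*-assoc (μU u) (cond u e) (X e))) (*-congʳ (μU*cond u e)))

  sum-cond : ∀ u → sum (cond u) ≈ 1#
  sum-cond u = *-cancelˡ (μU≉0 u) (begin
    μU u * sum (cond u)               ≈⟨ *-distribˡ-sum (μU u) (cond u) ⟩
    sum (λ e → μU u * cond u e)       ≈⟨ sum-cong (μU*cond u) ⟩
    μU u                              ≈⟨ *-identityʳ (μU u) ⟨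
    μU u * 1#                         ∎)

  𝔼∣-mean : ∀ u X → 𝔼∣ G u X ≈ mean (cond u) X
  𝔼∣-mean u X = *-cancelˡ (μU≉0 u) (begin
    μU u * 𝔼∣ G u X
      ≈⟨ *-/-cancel _ (μU≉0 u) ⟩
    sum (λ e → if does (source e ≟ u) then prob e * X e else 0#)
      ≈⟨ sum-cong (λ e → if-* (does (source e ≟ u)) (prob e) (X e)) ⟨
    mean (probAt u) X
      ≈⟨ μU*mean u X ⟨
    μU u * mean (cond u) X ∎)

  tower : ∀ X → mean μU (λ u → mean (cond u) X) ≈ mean prob X
  tower X = begin
    mean μU (λ u → mean (cond u) X)
      ≈⟨ sum-cong (λ u → μU*mean u X) ⟩
    sum (λ u → sum (λ e → probAt u e * X e))
      ≈⟨ ∑-comm (λ u e → probAt u e * X e) ⟩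
    sum (λ e → sum (λ u → probAt u e * X e))
      ≈⟨ sum-cong (λ e → trans (sym (*-distribʳ-sum (X e) (λ u → probAt u e)))
           (*-congʳ (sum-δ (source e) (λ _ → prob e)))) ⟩
    mean prob X ∎

  -- `μV` is the image of the edge law under `target`.
  mean-target : ∀ (Y : Fin #V → Carrier) → mean μV Y ≈ mean prob (λ e → Y (target e))
  mean-target Y = begin
    sum (λ v → μV v * Y v)
      ≈⟨ sum-cong (λ v → trans (*-distribʳ-sum (Y v) (λ e → if does (target e ≟ v) then prob e else 0#))
           (sum-cong λ e → if-* (does (target e ≟ v)) (prob e) (Y v))) ⟩
    sum (λ v → sum (λ e → if does (target e ≟ v) then prob e * Y v else 0#))
      ≈⟨ ∑-comm (λ v e → if does (target e ≟ v) then prob e * Y v else 0#) ⟩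
    sum (λ e → sum (λ v → if does (target e ≟ v) then prob e * Y v else 0#))
      ≈⟨ sum-cong (λ e → sum-δ (target e) (λ v → prob e * Y v)) ⟩
    mean prob (λ e → Y (target e)) ∎

  sum-μV : sum μV ≈ 1#
  sum-μV = trans (sym (mean-1 μV)) (trans (mean-target (λ _ → 1#)) (trans (mean-1 prob) sum-prob))

  -- The mean over a pair of edges e, e′ drawn independently at a common random u.
  pairMean : (Fin #E → Fin #E → Carrier) → Carrier
  pairMean F = mean μU (λ u → mean (cond u) (λ e → mean (cond u) (F e)))

  pairMean-cong : ∀ {F H} → (∀ e e′ → F e e′ ≈ H e e′) → pairMean F ≈ pairMean H
  pairMean-cong F≈H = mean-cong μU λ u → mean-cong (cond u) λ e → mean-cong (cond u) (F≈H e)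

  pairMean-mono : ∀ {F H} → (∀ e e′ → F e e′ ≤ H e e′) → pairMean F ≤ pairMean H
  pairMean-mono F≤H = mean-mono μU (λ u → proj₁ (μU>0 u)) λ u →
    mean-mono (cond u) (cond-nonneg u) λ e → mean-mono (cond u) (cond-nonneg u) (F≤H e)

  pairMean-+ : ∀ F H → pairMean (λ e e′ → F e e′ + H e e′) ≈ pairMean F + pairMean H
  pairMean-+ F H = trans
    (mean-cong μU λ u → trans (mean-cong (cond u) λ e → mean-+ (cond u) (F e) (H e))
      (mean-+ (cond u) (λ e → mean (cond u) (F e)) (λ e → mean (cond u) (H e))))
    (mean-+ μU (λ u → mean (cond u) (λ e → mean (cond u) (F e)))
               (λ u → mean (cond u) (λ e → mean (cond u) (H e))))

  pairMean-*ˡ : ∀ c F → pairMean (λ e e′ → c * F e e′) ≈ c * pairMean F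
  pairMean-*ˡ c F = trans
    (mean-cong μU λ u → trans (mean-cong (cond u) λ e → mean-*ˡ (cond u) c (F e))
      (mean-*ˡ (cond u) c (λ e → mean (cond u) (F e))))
    (mean-*ˡ μU c (λ u → mean (cond u) (λ e → mean (cond u) (F e))))

  pairMean-proj₁ : ∀ X → pairMean (λ e _ → X e) ≈ mean prob X
  pairMean-proj₁ X = trans
    (mean-cong μU λ u → mean-cong (cond u) λ e → mean-const (cond u) (sum-cond u) (X e))
    (tower X)

  pairMean-proj₂ : ∀ X → pairMean (λ _ e′ → X e′) ≈ mean prob X
  pairMean-proj₂ X = trans
    (mean-cong μU λ u → mean-const (cond u) (sum-cond u) (mean (cond u) X))
    (tower X)

  pairMean-const : ∀ c → pairMean (λ _ _ → c) ≈ c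
  pairMean-const c = trans (pairMean-proj₁ (λ _ → c)) (mean-const prob sum-prob c)

  push : (Fin #V → Fin #Σ → Carrier) → Fin #E → Fin #Σ → Carrier
  push f e α = sum (λ β → if constraint e α β then f (target e) β else 0#)

  agreement : (Fin #V → Fin #Σ → Carrier) → Fin #E → Fin #E → Carrier
  agreement f e e′ = sum (λ α → push f e α * push f e′ α)

  -- The square of an average over edges at `u` is an average over two independent edges at `u`; the
  -- sum over α then moves inside.
  energy : ∀ f → 𝔼U G (λ u → sum (λ α → apply G f u α * apply G f u α)) ≈ pairMean (agreement f)
  energy f = mean-cong μU λ u → begin
    sum (λ α → apply G f u α * apply G f u α)
      ≈⟨ sum-cong (λ α → *-cong (𝔼∣-mean u (λ e → push f e α)) (𝔼∣-mean u (λ e → push f e α))) ⟩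
    sum (λ α → mean (cond u) (λ e → push f e α) * mean (cond u) (λ e → push f e α))
      ≈⟨ sum-cong (λ α → mean-* (cond u) (λ e → push f e α) (λ e → push f e α)) ⟨
    sum (λ α → mean (cond u) (λ e → mean (cond u) (λ e′ → push f e α * push f e′ α)))
      ≈⟨ mean-sum (cond u) (λ e α → mean (cond u) (λ e′ → push f e α * push f e′ α)) ⟨
    mean (cond u) (λ e → sum (λ α → mean (cond u) (λ e′ → push f e α * push f e′ α)))
      ≈⟨ mean-cong (cond u) (λ e → mean-sum (cond u) (λ e′ α → push f e α * push f e′ α)) ⟨
    mean (cond u) (λ e → mean (cond u) (agreement f e)) ∎

  push-nonneg : ∀ {f} → Nonnegative G f → ∀ e α → 0# ≤ push f e α
  push-nonneg f≥0 e α = sum-nonneg λ β → if-nonneg (constraint e α β) (f≥0 (target e) β)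

  push≤1 : ∀ {f} → IsAssignment G f → ∀ e α → push f e α ≤ 1#
  push≤1 (f≥0 , f1) e α = order.≤-respʳ-≈ (f1 (target e))
    (sum-mono λ β → if-≤ (constraint e α β) (f≥0 (target e) β))

  -- After exchanging the two sums, each β contributes its mass at most once, and the masses at the
  -- target add up to 1.
  sum-push≤1 : ∀ {f} → IsAssignment G f → ∀ e → sum (push f e) ≤ 1#
  sum-push≤1 {f} (f≥0 , f1) e = order.≤-respʳ-≈ (f1 (target e))
    (order.≤-respˡ-≈ (sym (∑-comm (λ α β → if constraint e α β then f (target e) β else 0#)))
      (sum-mono λ β → sum-if-≤ (λ α → constraint e α β) (λ α α′ → projection e α α′ β)
        (f≥0 (target e) β)))

  agreement-nonneg : ∀ {f} → Nonnegative G f → ∀ e e′ → 0# ≤ agreement f e e′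
  agreement-nonneg f≥0 e e′ = sum-nonneg λ α → *-nonneg (push-nonneg f≥0 e α) (push-nonneg f≥0 e′ α)

  -- One factor is at most 1 for each α, and the other sums to at most 1 over α.
  agreement≤1 : ∀ {f} → IsAssignment G f → ∀ e e′ → agreement f e e′ ≤ 1#
  agreement≤1 {f} fA e e′ = order.trans
    (sum-mono λ α → order.≤-respʳ-≈ (*-identityʳ (push f e α))
      (*-monoˡ-≤ (push-nonneg (proj₁ fA) e α) (push≤1 fA e′ α)))
    (sum-push≤1 fA e)

  -- An edge reads the function at its target alone, so a factor depending only on the vertex comes
  -- out.
  push-scale : ∀ {h f} (w : Fin #V → Carrier) → (∀ v β → h v β ≈ w v * f v β) →
               ∀ e α → push h e α ≈ w (target e) * push f e α
  push-scale {h} {f} w h≈wf e α = trans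
    (sum-cong λ β → trans (if-cong (constraint e α β) (h≈wf (target e) β))
      (sym (*-if (constraint e α β) (w (target e)) (f (target e) β))))
    (sym (*-distribˡ-sum (w (target e)) (λ β → if constraint e α β then f (target e) β else 0#)))

  agreement-scale : ∀ {h f} (w : Fin #V → Carrier) → (∀ v β → h v β ≈ w v * f v β) →
                  ∀ e e′ → agreement h e e′ ≈ w (target e) * w (target e′) * agreement f e e′
  agreement-scale {h} {f} w h≈wf e e′ = trans
    (sum-cong λ α → trans (*-cong (push-scale w h≈wf e α) (push-scale w h≈wf e′ α))
      (solve 4 (λ a b x y → (a :* x) :* (b :* y) := (a :* b) :* (x :* y)) refl
        (w (target e)) (w (target e′)) (push f e α) (push f e′ α)))
    (sym (*-distribˡ-sum (w (target e) * w (target e′)) (λ α → push f e α * push f e′ α)))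

  sum-condProb : ∀ u (w : Fin #V → Carrier) → sum (λ v → condProb G u v * w v) ≈ mean (cond u) (λ e → w (target e))
  sum-condProb u w = begin
    sum (λ v → condProb G u v * w v)
      ≈⟨ sum-cong (λ v → trans (*-congʳ (𝔼∣-mean u (λ e → if does (target e ≟ v) then 1# else 0#)))
           (sym (mean-*ʳ (cond u) (λ e → if does (target e ≟ v) then 1# else 0#) (w v)))) ⟩
    sum (λ v → mean (cond u) (λ e → (if does (target e ≟ v) then 1# else 0#) * w v))
      ≈⟨ mean-sum (cond u) (λ e v → (if does (target e ≟ v) then 1# else 0#) * w v) ⟨
    mean (cond u) (λ e → sum (λ v → (if does (target e ≟ v) then 1# else 0#) * w v))
      ≈⟨ mean-cong (cond u) (λ e → trans
           (sum-cong λ v → if-* (does (target e ≟ v)) 1# (w v))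
           (trans (sum-δ (target e) (λ v → 1# * w v)) (*-identityˡ (w (target e))))) ⟩
    mean (cond u) (λ e → w (target e)) ∎

  sum-pairProb : ∀ v (w : Fin #V → Carrier) → sum (λ v′ → pairProb G v v′ * w v′) ≈
                 mean μU (λ u → condProb G u v * mean (cond u) (λ e → w (target e)))
  sum-pairProb v w = begin
    sum (λ v′ → pairProb G v v′ * w v′)
      ≈⟨ sum-cong (λ v′ → mean-*ʳ μU (λ u → condProb G u v * condProb G u v′) (w v′)) ⟨
    sum (λ v′ → mean μU (λ u → condProb G u v * condProb G u v′ * w v′))
      ≈⟨ mean-sum μU (λ u v′ → condProb G u v * condProb G u v′ * w v′) ⟨
    mean μU (λ u → sum (λ v′ → condProb G u v * condProb G u v′ * w v′))
      ≈⟨ mean-cong μU (λ u → trans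
           (sum-cong λ v′ → *-assoc (condProb G u v) (condProb G u v′) (w v′))
           (trans (sym (*-distribˡ-sum (condProb G u v) (λ v′ → condProb G u v′ * w v′)))
             (*-congˡ (sum-condProb u w)))) ⟩
    mean μU (λ u → condProb G u v * mean (cond u) (λ e → w (target e))) ∎

  -- Forgetting the second endpoint leaves the law of one edge. This identifies the denominator in
  -- `A`, which is therefore nonzero.
  pairProb-marginal : ∀ v → sum (pairProb G v) ≈ μV v
  pairProb-marginal v = begin
    sum (pairProb G v)
      ≈⟨ mean-1 (pairProb G v) ⟨
    sum (λ v′ → pairProb G v v′ * 1#)
      ≈⟨ sum-pairProb v (λ _ → 1#) ⟩
    mean μU (λ u → condProb G u v * mean (cond u) (λ _ → 1#))
      ≈⟨ mean-cong μU (λ u → trans (*-congˡ (mean-const (cond u) (sum-cond u) 1#))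
           (trans (*-identityʳ (condProb G u v))
             (𝔼∣-mean u (λ e → if does (target e ≟ v) then 1# else 0#)))) ⟩
    mean μU (λ u → mean (cond u) (λ e → if does (target e ≟ v) then 1# else 0#))
      ≈⟨ tower (λ e → if does (target e ≟ v) then 1# else 0#) ⟩
    mean prob (λ e → if does (target e ≟ v) then 1# else 0#)
      ≈⟨ sum-cong (λ e → trans (*-if (does (target e ≟ v)) (prob e) 1#)
           (if-cong (does (target e ≟ v)) (*-identityʳ (prob e)))) ⟩
    μV v ∎

  μV*A : ∀ v v′ → μV v * A G v v′ ≈ pairProb G v v′
  μV*A v v′ = trans (*-congʳ (sym (pairProb-marginal v)))
    (*-/-cancel (pairProb G v v′) λ eq → 0<x⇒x≉0 (μV>0 v) (trans (sym (pairProb-marginal v)) eq))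

  μV*sum-A : ∀ v (w : Fin #V → Carrier) → μV v * sum (λ v′ → A G v v′ * w v′) ≈ sum (λ v′ → pairProb G v v′ * w v′)
  μV*sum-A v w = trans (*-distribˡ-sum (μV v) (λ v′ → A G v v′ * w v′))
    (sum-cong λ v′ → trans (sym (*-assoc (μV v) (A G v v′) (w v′))) (*-congʳ (μV*A v v′)))

  A-stochastic : ∀ v → sum (A G v) ≈ 1#
  A-stochastic v = *-cancelˡ (0<x⇒x≉0 (μV>0 v)) (begin
    μV v * sum (A G v)                     ≈⟨ *-congˡ (mean-1 (A G v)) ⟨
    μV v * sum (λ v′ → A G v v′ * 1#)      ≈⟨ μV*sum-A v (λ _ → 1#) ⟩
    sum (λ v′ → pairProb G v v′ * 1#)      ≈⟨ mean-1 (pairProb G v) ⟩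
    sum (pairProb G v)                     ≈⟨ pairProb-marginal v ⟩
    μV v                                   ≈⟨ *-identityʳ (μV v) ⟨
    μV v * 1#                              ∎)

  -- Multiplying by `μV v` undoes the row normalisation of `A`; what remains is the mean over u of
  -- the squared conditional average of w, that is, an average over pairs.
  quadratic-form : ∀ (w : Fin #V → Carrier) → mean μV (λ v → w v * sum (λ v′ → A G v v′ * w v′)) ≈
                   pairMean (λ e e′ → w (target e) * w (target e′))
  quadratic-form w = begin
    sum (λ v → μV v * (w v * sum (λ v′ → A G v v′ * w v′)))
      ≈⟨ sum-cong (λ v → trans
           (solve 3 (λ m w s → m :* (w :* s) := w :* (m :* s)) refl
             (μV v) (w v) (sum (λ v′ → A G v v′ * w v′)))
           (*-congˡ (trans (μV*sum-A v w) (sum-pairProb v w)))) ⟩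
    -- Here `w` itself is the weight, which makes the exchange of the sums over v and u an instance
    -- of `mean-comm`.
    mean w (λ v → mean μU (λ u → condProb G u v * local u))
      ≈⟨ mean-comm w μU (λ v u → condProb G u v * local u) ⟩
    mean μU (λ u → mean w (λ v → condProb G u v * local u))
      ≈⟨ mean-cong μU (λ u → trans (mean-*ʳ w (λ v → condProb G u v) (local u))
           (*-congʳ (trans (sum-cong λ v → *-comm (w v) (condProb G u v)) (sum-condProb u w)))) ⟩
    mean μU (λ u → local u * local u)
      ≈⟨ mean-cong μU (λ u → mean-* (cond u) (λ e → w (target e)) (λ e → w (target e))) ⟨
    pairMean (λ e e′ → w (target e) * w (target e′)) ∎
    where
    local : Fin #U → Carrier
    local u = mean (cond u) (λ e → w (target e))

-- From an optimal function to an assignment.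

module Rounding {ℓ : Level} (ℝ : CompleteOrderedField ℓ)
  (G : ProjectionGames.ProjectionGame ℝ) where
  open CompleteOrderedField ℝ
  open ring using (refl; sym; trans; +-cong; +-congʳ; *-congˡ; *-congʳ; *-identityʳ; zeroˡ)
  open IntegerCoefficients commutativeRing using (⟦_⟧; solve; con; _:+_; _:*_; _:-_; _:=_)
  open OrderedField ℝ
  open WeightedSums ℝ
  open GameMeans ℝ G
  open ProjectionGames ℝ using (𝔼U; apply; A; Nonnegative; IsAssignment; IsExpanding;
    nontrivialMax)
  open ProjectionGames.IsSpectrum using (decreasing; vec; orthonorm; spanning; eigen)
  open ProjectionGames.ProjectionGame G
  open SpectralGap ℝ
  open SemiringSum ring.semiring using (*-distribˡ-sum)

  mass : (Fin #V → Fin #Σ → Carrier) → Fin #V → Carrier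
  mass h v = sum (h v)

  -- At a vertex of mass zero there is nothing to normalise, so the values of a given assignment
  -- `f₀` are used. The theorem takes `f₀` from the attained collision value, which avoids choosing
  -- a symbol of the alphabet.
  normalise : (f₀ h : Fin #V → Fin #Σ → Carrier) → Fin #V → Fin #Σ → Carrier
  normalise f₀ h v β with mass h v order.≟ 0#
  ... | yes _ = f₀ v β
  ... | no  _ = h v β / mass h v

  normalise-isAssignment : ∀ {f₀ h} → IsAssignment G f₀ → Nonnegative G h →
                           IsAssignment G (normalise f₀ h)
  normalise-isAssignment {f₀} {h} (f₀≥0 , f₀1) h≥0 = nonneg , total
    where
    nonneg : Nonnegative G (normalise f₀ h)
    nonneg v β with mass h v order.≟ 0#
    ... | yes _   = f₀≥0 v β
    ... | no  w≉0 = *-cancelˡ-nonneg (sum-nonneg (h≥0 v) , λ 0≈w → w≉0 (sym 0≈w))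
      (order.≤-respʳ-≈ (sym (*-/-cancel (h v β) w≉0)) (h≥0 v β))

    total : ∀ v → sum (normalise f₀ h v) ≈ 1#
    total v with mass h v order.≟ 0#
    ... | yes _   = f₀1 v
    ... | no  w≉0 = *-cancelˡ w≉0 (trans (*-distribˡ-sum (mass h v) (λ β → h v β / mass h v))
      (trans (sum-cong λ β → *-/-cancel (h v β) w≉0) (sym (*-identityʳ (mass h v)))))

  -- Nonnegativity covers vertices of mass zero: there h vanishes identically, so the fallback
  -- values do no harm.
  mass*normalise : ∀ {f₀ h} → Nonnegative G h → ∀ v β → h v β ≈ mass h v * normalise f₀ h v β
  mass*normalise {f₀} {h} h≥0 v β with mass h v order.≟ 0#
  ... | yes w≈0 = trans (sum-zero⇒zero (h≥0 v) w≈0 β) (sym (trans (*-congʳ w≈0) (zeroˡ (f₀ v β))))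
  ... | no  w≉0 = sym (*-/-cancel (h v β) w≉0)

  energyU : (Fin #V → Fin #Σ → Carrier) → Carrier
  energyU f = 𝔼U G (λ u → sum (λ α → apply G f u α * apply G f u α))

  correlation : (Fin #V → Carrier) → Carrier
  correlation w = pairMean (λ e e′ → w (target e) * w (target e′))

  deviation : (Fin #V → Carrier) → Carrier → Carrier
  deviation w c = mean μV (λ v → (w v - c) ²)

  energyU-nonneg : ∀ {f} → Nonnegative G f → 0# ≤ energyU f
  energyU-nonneg {f} f≥0 = order.≤-respʳ-≈ (sym (energy f))
    (order.≤-respˡ-≈ (pairMean-const 0#) (pairMean-mono (agreement-nonneg f≥0)))

  -- For K in [0 , 1] the right-hand side exceeds the left-hand side by
  -- (1 - K) (x + y - c)² + K ((x - c)² + (y - c)²).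
  pointwise : ∀ c x y {K} → 0# ≤ K → K ≤ 1# →
    c ² + ⟦ + 2 ⟧ * (x * y * K) ≤ (c ² * K + ⟦ + 2 ⟧ * (x * y)) + ((x - c) ² + (y - c) ²)
  pointwise c x y {K} 0≤K K≤1 = x+d≈y⇒x≤y
    (+-nonneg (*-nonneg (x≤y⇒0≤y-x K≤1) (0≤x² (x + y - c)))
      (*-nonneg 0≤K (+-nonneg (0≤x² (x - c)) (0≤x² (y - c)))))
    (solve 4 (λ c x y K →
      (c :* c :+ con (+ 2) :* (x :* y :* K)) :+
        ((con (+ 1) :- K) :* ((x :+ y :- c) :* (x :+ y :- c)) :+
          K :* ((x :- c) :* (x :- c) :+ (y :- c) :* (y :- c))) :=
      (c :* c :* K :+ con (+ 2) :* (x :* y)) :+ ((x :- c) :* (x :- c) :+ (y :- c) :* (y :- c)))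
      refl c x y K)

  module _ {f : Fin #V → Fin #Σ → Carrier} (fA : IsAssignment G f) where

    energyU≤1 : energyU f ≤ 1#
    energyU≤1 = order.≤-respˡ-≈ (sym (energy f))
      (order.≤-respʳ-≈ (pairMean-const 1#) (pairMean-mono (agreement≤1 fA)))

    module _ {h : Fin #V → Fin #Σ → Carrier} (w : Fin #V → Carrier)
      (h≈wf : ∀ v β → h v β ≈ w v * f v β) where

      energyU-scale : energyU h ≈ pairMean (λ e e′ → w (target e) * w (target e′) * agreement f e e′)
      energyU-scale = trans (energy h) (pairMean-cong (agreement-scale w h≈wf))

      energyU≤correlation : (∀ v → 0# ≤ w v) → energyU h ≤ correlation w
      energyU≤correlation 0≤w = order.≤-respˡ-≈ (sym energyU-scale)
        (pairMean-mono λ e e′ → order.≤-respʳ-≈ (*-identityʳ _)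
          (*-monoˡ-≤ (*-nonneg (0≤w (target e)) (0≤w (target e′))) (agreement≤1 fA e e′)))

      -- The average of `pointwise` over pairs of edges. Each target of a pair is distributed by
      -- `μV`, so each of the two squares contributes one `deviation`. Terms are arranged to avoid
      -- subtraction.
      rounding : ∀ c → c ² + ⟦ + 2 ⟧ * energyU h ≤
                 (c ² * energyU f + ⟦ + 2 ⟧ * correlation w) + (deviation w c + deviation w c)
      rounding c = order.≤-respˡ-≈ lhs (order.≤-respʳ-≈ rhs mid)
        where
        dev : Fin #E → Carrier
        dev e = (w (target e) - c) ²
        ww : Fin #E → Fin #E → Carrier
        ww e e′ = w (target e) * w (target e′)
        K = agreement f
        L R : Fin #E → Fin #E → Carrier
        L e e′ = c ² + ⟦ + 2 ⟧ * (ww e e′ * K e e′)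
        R e e′ = (c ² * K e e′ + ⟦ + 2 ⟧ * ww e e′) + (dev e + dev e′)

        mid : pairMean L ≤ pairMean R
        mid = pairMean-mono {L} {R} λ e e′ → pointwise c (w (target e)) (w (target e′))
          (agreement-nonneg (proj₁ fA) e e′) (agreement≤1 fA e e′)

        lhs : pairMean L ≈ c ² + ⟦ + 2 ⟧ * energyU h
        lhs = trans (pairMean-+ (λ _ _ → c ²) (λ e e′ → ⟦ + 2 ⟧ * (ww e e′ * K e e′)))
          (+-cong (pairMean-const (c ²))
            (trans (pairMean-*ˡ ⟦ + 2 ⟧ (λ e e′ → ww e e′ * K e e′)) (*-congˡ (sym energyU-scale))))

        rhs : pairMean R ≈
              (c ² * energyU f + ⟦ + 2 ⟧ * correlation w) + (deviation w c + deviation w c)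
        rhs = trans
          (pairMean-+ (λ e e′ → c ² * K e e′ + ⟦ + 2 ⟧ * ww e e′) (λ e e′ → dev e + dev e′))
          (+-cong
            (trans (pairMean-+ (λ e e′ → c ² * K e e′) (λ e e′ → ⟦ + 2 ⟧ * ww e e′))
              (+-cong (trans (pairMean-*ˡ (c ²) K) (*-congˡ (sym (energy f))))
                (pairMean-*ˡ ⟦ + 2 ⟧ ww)))
            (trans (pairMean-+ (λ e _ → dev e) (λ _ e′ → dev e′))
              (+-cong
                (trans (pairMean-proj₁ dev) (sym (mean-target (λ v → (w v - c) ²))))
                (trans (pairMean-proj₂ dev) (sym (mean-target (λ v → (w v - c) ²)))))))

  expansion : ∀ {γ} → 0# < γ → IsExpanding γ G → ∀ (w : Fin #V → Carrier) →
    ∃[ c ] mean μV (λ v → w v ²) ≈ c ² + deviation w c ×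
           correlation w + γ * deviation w c ≤ mean μV (λ v → w v ²)
  expansion {γ} 0<γ (λs , S , γ≤) w =
    proj₁ gap , proj₁ (proj₂ gap) ,
      order.≤-respˡ-≈ (+-congʳ (quadratic-form w)) (proj₂ (proj₂ gap))
    where
    gap = spectral-gap μV (A G) λs (vec S) (orthonorm S) (eigen S) (decreasing S) (spanning S)
      sum-μV A-stochastic γ 0<γ γ≤ w

  -- `nontrivialMax` is nonnegative, also in its default value for a single vertex.
  γ≤1 : ∀ {γ} → IsExpanding γ G → γ ≤ 1#
  γ≤1 (λs , _ , γ≤) = order.trans γ≤
    (x+d≈y⇒x≤y (nontrivialMax-nonneg λs) (solve 2 (λ x m → (x :- m) :+ m := x) refl 1# (nontrivialMax λs)))

-- The numerical contradiction.

module Quantitative {ℓ : Level} (ℝ : CompleteOrderedField ℓ) where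
  open CompleteOrderedField ℝ
  open ring using (refl; sym; trans; +-cong; +-congˡ; +-congʳ; *-cong; *-congˡ; *-identityʳ;
    zeroʳ)
  open IntegerCoefficients commutativeRing using (⟦_⟧; solve; con; _:+_; _:*_; _:-_; :-_; _:=_)
  open OrderedField ℝ

  *-cancelˡ-pos : ∀ {x y} → 0# < x → 0# < x * y → 0# < y
  *-cancelˡ-pos 0<x (0≤xy , 0≉xy) = *-cancelˡ-nonneg 0<x 0≤xy ,
    λ 0≈y → 0≉xy (sym (trans (*-congˡ (sym 0≈y)) (zeroʳ _)))

  -- The reading is S = ‖Gh‖, N = ‖Th‖, X = S², Y = N², Q = ⟨ w , A w ⟩, D = ‖w - c‖², F = ‖Gf‖² and
  -- ρ = 16 ε / γ. The hypothesis F ≤ 1 - ρ is what the negated conclusion supplies.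
  module _ {γ ε ρ X Q Y D F N S c : Carrier}
    (0<γ : 0# < γ) (γ≤1 : γ ≤ 1#) (γρ≈16ε : γ * ρ ≈ ⟦ + 16 ⟧ * ε)
    (0≤F : 0# ≤ F) (F≤1-ρ : F ≤ 1# - ρ)
    (0<N : 0# < N) (N²≈Y : N ² ≈ Y) (S²≈X : S ² ≈ X) (gain : 0# < S - N * (1# - ε))
    (0≤D : 0# ≤ D) (Y≈c²+D : Y ≈ c ² + D) (X≤Q : X ≤ Q) (Q+γD≤Y : Q + γ * D ≤ Y)
    (rounding : c ² + ⟦ + 2 ⟧ * X ≤ (c ² * F + ⟦ + 2 ⟧ * Q) + (D + D))
    where

    private
      0≤1-ρ : 0# ≤ 1# - ρ
      0≤1-ρ = order.trans 0≤F F≤1-ρ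

      0<Y : 0# < Y
      0<Y = <-respʳ-≈ N²≈Y (*-pos 0<N 0<N)

      -- Writes 16 - γ ρ as a sum of nonnegative terms, since γ and ρ are both at most 1.
      16[1-ε]≈ : ⟦ + 15 ⟧ + (1# - γ + γ * (1# - ρ)) ≈ ⟦ + 16 ⟧ * (1# - ε)
      16[1-ε]≈ = trans
        (solve 2 (λ g r → con (+ 15) :+ (con (+ 1) :- g :+ g :* (con (+ 1) :- r))
           := con (+ 16) :- g :* r) refl γ ρ)
        (trans (+-congˡ (ring.-‿cong γρ≈16ε))
          (solve 1 (λ e → con (+ 16) :- con (+ 16) :* e := con (+ 16) :* (con (+ 1) :- e)) refl ε))

      0≤1-ε : 0# ≤ 1# - ε
      0≤1-ε = *-cancelˡ-nonneg (0<n 15) (order.≤-respʳ-≈ 16[1-ε]≈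
        (+-nonneg (0≤n 15) (+-nonneg (x≤y⇒0≤y-x γ≤1) (*-nonneg (proj₁ 0<γ) 0≤1-ρ))))

      t : Carrier
      t = N * (1# - ε)

      0≤t : 0# ≤ t
      0≤t = *-nonneg (proj₁ 0<N) 0≤1-ε

      -- This is 8 ((S - t) (S + t) + ε² N²) with t = N (1 - ε); the ε² term cancels the one from (1
      -- - ε)², leaving a loss of 2 ε.
      0<8[X-Y]+γρY : 0# < ⟦ + 8 ⟧ * (X - Y) + γ * ρ * Y
      0<8[X-Y]+γρY = <-respʳ-≈
        (trans
          (solve 3 (λ s n e →
            con (+ 8) :* ((s :- n :* (con (+ 1) :- e)) :* ((s :- n :* (con (+ 1) :- e)) :+
                (n :* (con (+ 1) :- e) :+ n :* (con (+ 1) :- e))) :+ (e :* e) :* (n :* n))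
              := con (+ 8) :* (s :* s :- n :* n) :+ (con (+ 16) :* e) :* (n :* n))
            refl S N ε)
          (+-cong (*-congˡ (+-cong S²≈X (ring.-‿cong N²≈Y))) (*-cong (sym γρ≈16ε) N²≈Y)))
        (*-pos (0<n 7) (+-pos-nonneg
          (*-pos gain (+-pos-nonneg gain (+-nonneg 0≤t 0≤t)))
          (*-nonneg (0≤x² ε) (0≤x² N))))

      -- From γ D ≤ Y - Q ≤ Y - X < γ ρ Y / 8, dividing by γ. As D ≥ 0, this also yields ρ Y > 0
      -- with no assumption on the sign of ε.
      0<ρY-8D : 0# < ρ * Y - ⟦ + 8 ⟧ * D
      0<ρY-8D = *-cancelˡ-pos 0<γ (<-respʳ-≈
        (solve 6 (λ X Y Q D g r →
          (con (+ 8) :* (X :- Y) :+ g :* r :* Y) :+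
            con (+ 8) :* ((Y :- (Q :+ g :* D)) :+ (Q :- X)) :=
          g :* (r :* Y :- con (+ 8) :* D)) refl X Y Q D γ ρ)
        (+-pos-nonneg 0<8[X-Y]+γρY
          (*-nonneg (0≤n 8) (+-nonneg (x≤y⇒0≤y-x Q+γD≤Y) (x≤y⇒0≤y-x X≤Q)))))

      0<ρY : 0# < ρ * Y
      0<ρY = <-respʳ-≈ (solve 2 (λ z d → (z :- con (+ 8) :* d) :+ con (+ 8) :* d := z) refl (ρ * Y) D)
        (+-pos-nonneg 0<ρY-8D (*-nonneg (0≤n 8) 0≤D))

      -- Uses ρ ≤ 1 - F in `rounding`, and Q ≤ Y.
      c²ρ≤ : c ² * ρ ≤ ⟦ + 2 ⟧ * (Y - X) + ⟦ + 2 ⟧ * D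
      c²ρ≤ = x+d≈y⇒x≤y
        (+-nonneg
          (+-nonneg (x≤y⇒0≤y-x rounding) (*-nonneg (0≤x² c) (x≤y⇒0≤y-x F≤1-ρ)))
          (*-nonneg (0≤n 2) (+-nonneg (x≤y⇒0≤y-x Q+γD≤Y) (*-nonneg (proj₁ 0<γ) 0≤D))))
        (solve 8 (λ k r F Q D X Y g →
          k :* r :+ (((((k :* F :+ con (+ 2) :* Q) :+ (D :+ D)) :- (k :+ con (+ 2) :* X)) :+
              k :* ((con (+ 1) :- r) :- F)) :+
            con (+ 2) :* ((Y :- (Q :+ g)) :+ g)) :=
          con (+ 2) :* (Y :- X) :+ con (+ 2) :* D) refl (c ²) ρ F Q D X Y (γ * D))

      -- The third D is the cost of replacing c² by Y - D, where ρ D ≤ D.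
      ρY≤ : ρ * Y ≤ ⟦ + 2 ⟧ * (Y - X) + ⟦ + 3 ⟧ * D
      ρY≤ = order.≤-respˡ-≈ (*-congˡ (sym Y≈c²+D)) (x+d≈y⇒x≤y
        (+-nonneg (x≤y⇒0≤y-x c²ρ≤) (*-nonneg 0≤D 0≤1-ρ))
        (solve 5 (λ k r D X Y →
          r :* (k :+ D) :+ (((con (+ 2) :* (Y :- X) :+ con (+ 2) :* D) :- k :* r) :+
            D :* (con (+ 1) :- r)) :=
          con (+ 2) :* (Y :- X) :+ con (+ 3) :* D) refl (c ²) ρ D X Y))

      -- Eight times the previous bound: 8 ρ Y ≤ 16 (Y - X) + 24 D ≤ 2 γ ρ Y + 3 ρ Y ≤ 5 ρ Y.
      3ρY≤0 : ⟦ + 3 ⟧ * (ρ * Y) ≤ 0#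
      3ρY≤0 = x+d≈y⇒x≤y
        (+-nonneg
          (+-nonneg (*-nonneg (0≤n 8) (x≤y⇒0≤y-x ρY≤)) (*-nonneg (0≤n 3) (proj₁ 0<ρY-8D)))
          (*-nonneg (0≤n 2)
            (+-nonneg (proj₁ 0<8[X-Y]+γρY) (*-nonneg (x≤y⇒0≤y-x γ≤1) (proj₁ 0<ρY)))))
        (solve 5 (λ D X Y g r →
          con (+ 3) :* (r :* Y) :+
            ((con (+ 8) :* ((con (+ 2) :* (Y :- X) :+ con (+ 3) :* D) :- r :* Y) :+
                con (+ 3) :* (r :* Y :- con (+ 8) :* D)) :+
              con (+ 2) :* ((con (+ 8) :* (X :- Y) :+ g :* r :* Y) :+ (con (+ 1) :- g) :* (r :* Y))) :=
          con +0) refl D X Y γ ρ)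

    value-gap-absurd : ⊥
    value-gap-absurd = <⇒≱ (*-pos (0<n 2) 0<ρY) 3ρY≤0

-- Assembly, with C = 16.

theorem3p4 : ∀ {ℓ} (ℝ : CompleteOrderedField ℓ) →
    let open CompleteOrderedField ℝ
        open ProjectionGames ℝ in
    ∃[ C ] 0# < C ×
      (∀ (γ ε : Carrier) (G : ProjectionGame) (λ₊ ‖G‖ : Carrier) →
        0# < γ → IsExpanding γ G →
        Isλ₊ G λ₊ → 1# - ε < λ₊ →
        IsCollisionValue G ‖G‖ → 1# - C * ε / γ < ‖G‖)
theorem3p4 ℝ = ⟦ + 16 ⟧ , 0<n 15 ,
  λ { γ ε G λ₊ ‖G‖ 0<γ expanding ((h , h≥0 , N≉0 , λ₊≈) , _) 1-ε<λ₊ ((f₀ , f₀A , _) , maximal) →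
    let open Rounding ℝ G
        open ProjectionGame G using (μV; μV>0)
        w        = mass h
        f        = normalise f₀ h
        fA       = normalise-isAssignment f₀A h≥0
        h≈wf     = mass*normalise {f₀} h≥0
        0≤w      = λ v → sum-nonneg (h≥0 v)
        N        = normT G h
        S        = normU G (apply G h)
        μV≥0     = λ v → proj₁ (μV>0 v)
        0≤Y      = mean-nonneg μV μV≥0 (λ v → 0≤x² (w v))
        c , Y≈c²+D , Q+γD≤Y = expansion 0<γ expanding w
        0≤D      = mean-nonneg μV μV≥0 (λ v → 0≤x² (w v - c))
        0≤F      = energyU-nonneg (proj₁ fA)
        0≤X      = energyU-nonneg h≥0
        -- From F ≤ 1 follows F² ≤ F, so a lower bound on ‖Gf‖² is already one on ‖Gf‖.
        F≤√F     = √-upper (order.≤-respʳ-≈ (ring.*-identityʳ _) (*-monoˡ-≤ 0≤F (energyU≤1 fA)))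
        F≤‖G‖    = order.trans F≤√F (maximal (normU G (apply G f)) (f , fA , ring.refl))
        0<N      = √-nonneg 0≤Y , λ 0≈N → N≉0 (ring.sym 0≈N)
        Nλ₊≈S    = ring.trans (ring.*-congˡ λ₊≈) (*-/-cancel S N≉0)
        gain     = <-respʳ-≈
          (ring.trans (solve 3 (λ n l e → n :* (l :- e) := n :* l :- n :* e) ring.refl N λ₊ (1# - ε))
            (ring.+-congʳ Nλ₊≈S))
          (*-pos 0<N (x<y⇒0<y-x 1-ε<λ₊))
    in ≰⇒> λ ‖G‖≤1-ρ → value-gap-absurd 0<γ (γ≤1 expanding)
         (*-/-cancel (⟦ + 16 ⟧ * ε) (0<x⇒x≉0 0<γ))
         0≤F (order.trans F≤‖G‖ ‖G‖≤1-ρ)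
         0<N (√² 0≤Y) (√² 0≤X) gain 0≤D Y≈c²+D
         (energyU≤correlation fA w h≈wf 0≤w) Q+γD≤Y (rounding fA w h≈wf c) }
  where
  open CompleteOrderedField ℝ
  open ProjectionGames ℝ
  open IntegerCoefficients commutativeRing using (⟦_⟧; solve; _:*_; _:-_; _:=_)
  open OrderedField ℝ
  open WeightedSums ℝ
  open Quantitative ℝ
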